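{- Let $B$ be a finite subset of $\mathrm{L}$. Then $\mathrm{SAT}(\{\mathsf{X}\},B)$ can be decided in polynomial time.
   Context: A Boolean function is a map $f:\{0,1\}^n\to\{0,1\}$; each is used as an $n$-ary propositional connective. $\mathrm{L}$ is the set of linear Boolean functions, i.e. those of the form $f(x_1,\dots,x_n)=x_{i_1}\oplus\dots\oplus x_{i_k}\oplus c$ for some variables among $x_1,\dots,x_n$ and a constant $c\in\{0,1\}$, where $\oplus$ is exclusive or. A temporal $B$-formula over $\{\mathsf{X}\}$ is built from propositional variables using connectives from $B$ and the unary operator $\mathsf{X}$. A structure $S=(s,V,\xi)$ is an infinite sequence $(s_i)_{i\in\mathbb N}$ of distinct states, a variable set $V$, and $\xi$ assigning to each state the set of variables true there. Semantics: $S,s_i\models x$ iff $x\in\xi(s_i)$; Boolean connectives pointwise; $S,s_i\models\mathsf{X}\varphi$ iff $S,s_{i+1}\models\varphi$. A formula is satisfiable if it holds at some state of some structure. $\mathrm{SAT}(\{\mathsf{X}\},B)$ is the problem of deciding satisfiability of temporal $B$-formulae over $\{\mathsf{X}\}$. -}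

module Defs where

open import Data.Nat using (ℕ; zero; suc; _+_; _*_; _^_)
open import Data.Nat.Binary.Base using (ℕᵇ; 2[1+_]; 1+[2_]) renaming (zero to bzero; fromℕ to toBin)
open import Data.Bool using (Bool; true; false; _xor_; _∧_)
open import Data.Fin using (Fin; toℕ; _↑ˡ_) renaming (zero to fzero; suc to fsuc)
open import Data.Vec using (Vec; []; _∷_; zipWith; foldr)
open import Data.List using (List; []; _∷_; _++_; length; lookup; [_])
open import Data.Product using (Σ; _×_; _,_; proj₁; proj₂)
open import Data.Sum using (_⊎_; inj₁; inj₂)
open import Relation.Binary.PropositionalEquality using (_≡_)
open import Function.Bundles using (_⇔_)

BFun : Set
BFun = Σ ℕ (λ n → Vec Bool n → Bool)

arity : BFun → ℕ
arity = proj₁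

IsLinear : BFun → Set
IsLinear (n , f) =
  Σ (Vec Bool n) λ S → Σ Bool λ c →
    ∀ (x : Vec Bool n) → f x ≡ foldr (λ _ → Bool) _xor_ c (zipWith _∧_ S x)

-- Temporal B-formulae over {X}.  B is a finite set of Boolean
-- functions, given as a list; connectives are referred to by index.

data Form (B : List BFun) : Set where
  var : ℕ → Form B
  X   : Form B → Form B
  app : (j : Fin (length B)) → Vec (Form B) (arity (lookup B j)) → Form B

-- Semantics.  A structure: states s_0, s_1, ... (indexed by ℕ), the
-- variables are x_0, x_1, ... (indexed by ℕ); ξ i v = true iff x_v is
-- true in state s_i.

Structure : Set
Structure = ℕ → ℕ → Bool

mutual
  eval : {B : List BFun} → Structure → ℕ → Form B → Bool
  eval ξ i (var v) = ξ i v
  eval ξ i (X φ) = eval ξ (suc i) φ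
  eval {B} ξ i (app j φs) = proj₂ (lookup B j) (evalVec ξ i φs)

  evalVec : {B : List BFun} {n : ℕ} → Structure → ℕ → Vec (Form B) n → Vec Bool n
  evalVec ξ i [] = []
  evalVec ξ i (φ ∷ φs) = eval ξ i φ ∷ evalVec ξ i φs

_,_⊨_ : {B : List BFun} → Structure → ℕ → Form B → Set
ξ , i ⊨ φ = eval ξ i φ ≡ true

Satisfiable : {B : List BFun} → Form B → Set
Satisfiable φ = Σ Structure λ ξ → Σ ℕ λ i → ξ , i ⊨ φ

-- Encoding of formulae as words over a fixed 6-letter input alphabet
--   s0 s1 : digits,  V : variable,  Xs : next,  C : connective,  E : end.
-- Numbers are written in bijective binary (digits 1,2 written s0,s1),
-- least significant digit first, so their length is logarithmic.

Σin : Set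
Σin = Fin 6

s0 s1 sV sX sC sE : Σin
s0 = fzero
s1 = fsuc fzero
sV = fsuc (fsuc fzero)
sX = fsuc (fsuc (fsuc fzero))
sC = fsuc (fsuc (fsuc (fsuc fzero)))
sE = fsuc (fsuc (fsuc (fsuc (fsuc fzero))))

binDigits : ℕᵇ → List Σin
binDigits bzero = []
binDigits 1+[2 x ] = s0 ∷ binDigits x
binDigits 2[1+ x ] = s1 ∷ binDigits x

encℕ : ℕ → List Σin
encℕ n = binDigits (toBin n)

mutual
  enc : {B : List BFun} → Form B → List Σin
  enc (var v) = sV ∷ encℕ v ++ [ sE ]
  enc (X φ) = sX ∷ enc φ
  enc (app j φs) = sC ∷ encℕ (toℕ j) ++ sE ∷ encVec φs

  encVec : {B : List BFun} {n : ℕ} → Vec (Form B) n → List Σin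
  encVec [] = []
  encVec (φ ∷ φs) = enc φ ++ encVec φs

SATLang : (B : List BFun) → List Σin → Set
SATLang B w = Σ (Form B) λ φ → (enc φ ≡ w) × Satisfiable φ

-- Deterministic one-tape Turing machines (two-way infinite tape).
-- Tape alphabet Fin (7 + k): 0 = blank, 1..6 = input letters, rest extra.

data Move : Set where
  left right stay : Move

record TM : Set where
  field
    nQ    : ℕ
    k     : ℕ
    start : Fin nQ
    -- transition: new state or halt with a Boolean answer, symbol written, head move
    δ     : Fin nQ → Fin (7 + k) → (Fin nQ ⊎ Bool) × Fin (7 + k) × Move

module _ (M : TM) where
  open TM M

  Γ : Set
  Γ = Fin (7 + k)

  blank : Γ
  blank = fzero

  inSym : Σin → Γ
  inSym a = fsuc (a ↑ˡ k)

  record Config : Set where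
    constructor conf
    field
      state : Fin nQ
      lft   : List Γ   -- cells left of the head, nearest first
      hd    : Γ
      rgt   : List Γ   -- cells right of the head, nearest first

  moveHead : Move → List Γ → Γ → List Γ → List Γ × Γ × List Γ
  moveHead left [] h r = [] , blank , h ∷ r
  moveHead left (a ∷ l) h r = l , a , h ∷ r
  moveHead right l h [] = h ∷ l , blank , []
  moveHead right l h (a ∷ r) = h ∷ l , a , r
  moveHead stay l h r = l , h , r

  step : Config → Config ⊎ Bool
  step (conf q l h r) with δ q h
  ... | inj₂ b , _ , _ = inj₂ b
  ... | inj₁ q' , a , m with moveHead m l a r
  ...   | l' , h' , r' = inj₁ (conf q' l' h' r')

  run : ℕ → Config → Config ⊎ Bool
  run zero c = inj₁ c
  run (suc t) c with step c
  ... | inj₁ c' = run t c'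
  ... | inj₂ b = inj₂ b

  initConf : List Σin → Config
  initConf [] = conf start [] blank []
  initConf (a ∷ w) = conf start [] (inSym a) (Data.List.map inSym w)

PolyTimeDecidable : (List Σin → Set) → Set
PolyTimeDecidable P =
  Σ TM λ M → Σ ℕ λ c → Σ ℕ λ d →
    ∀ (w : List Σin) → Σ Bool λ b →
      (run M (c * (suc (length w)) ^ d) (initConf M w) ≡ inj₂ b)
      × (b ≡ true ⇔ P w)

{-# OPTIONS --safe #-}
module Submission where

-- For linear connectives the value of φ at a state is a constant plus, over GF(2), the sum of ξ (i + d) v
-- over those occurrences of a variable v that are relevant, i.e. have coefficient 1 at every connective
-- above them, where d is the number of X's above the occurrence.  Cancelling equal pairs (d , v) leaves
-- a constant plus a sum over a set of distinct pairs, whose values may be chosen independently: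
-- φ is satisfiable iff that set is nonempty or the constant is 1.  The set and the constant are computed
-- in one left-to-right pass over the prefix encoding of φ by a program with finitely many stacks, which a
-- one-tape Turing machine simulates with polynomial overhead.

open import Defs
open import Data.Bool using (Bool; true; false; not; if_then_else_; _∧_; _xor_) renaming (T to IsTrue)
open import Data.Bool.Properties using (xor-assoc; xor-comm; xor-same; xor-identityʳ; ∧-assoc)
open import Data.Empty using (⊥-elim)
open import Data.Fin using (Fin; toℕ; fromℕ<; _↑ʳ_; splitAt; join) renaming (zero to fzero; suc to fsuc)
open import Data.Fin.Properties using (splitAt-join; splitAt-↑ˡ; toℕ-fromℕ<; toℕ<n; toℕ-injective) renaming (_≟_ to _≟ᶠ_)
open import Data.List using (List; []; _∷_; length; head; drop; map; _++_; _ʳ++_; reverse; replicate; foldr; foldl)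
import Data.List as List
open import Data.List.Properties using (++-ʳ++; ʳ++-ʳ++; ʳ++-defn; length-ʳ++; length-++; ++-identityʳ; ++-assoc; reverse-injective; length-replicate; length-map; ∷-injectiveʳ; foldl-ʳ++; map-ʳ++)
open import Data.List.Relation.Unary.All using (All; []; _∷_)
open import Data.List.Relation.Unary.AllPairs using ([]; _∷_)
open import Data.List.Relation.Unary.Unique.Propositional using (Unique)
open import Data.Maybe using (Maybe; just; nothing; maybe′)
open import Data.Nat using (ℕ; zero; suc; _+_; _*_; _^_; _≤_; _<_; s≤s; z≤n; _⊓_; pred; _<?_; _≡ᵇ_)
open import Data.Nat.Binary.Base using (ℕᵇ; 2[1+_]; 1+[2_]) renaming (zero to bzero; fromℕ to toBin; toℕ to fromBin)
open import Data.Nat.Binary.Properties using () renaming (toℕ-fromℕ to fromBin-toBin; fromℕ-toℕ to toBin-fromBin)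
open import Data.Nat.Properties
open import Data.Nat.Tactic.RingSolver using (solve-∀)
open import Data.Product using (Σ; ∃; _×_; _,_; proj₁; proj₂)
open import Data.Sum using (_⊎_; inj₁; inj₂; [_,_]′) renaming (map to map⊎; map₁ to map⊎₁)
open import Data.Unit using (⊤; tt)
open import Data.Vec using (Vec; []; _∷_; updateAt; zipWith; _[_]≔_)
import Data.Vec as Vec
open import Data.Vec.Properties using (lookup∘updateAt; lookup∘updateAt′; lookup∘update; lookup∘update′; lookup-replicate)
open import Function using (_∘_; id; _⇔_; mk⇔; Equivalence)
open import Relation.Binary.PropositionalEquality using (_≡_; _≢_; refl; sym; trans; cong; cong₂; subst; _≗_; module ≡-Reasoning)
open import Relation.Nullary using (yes; no; does; ¬_; Dec)
open import Relation.Nullary.Decidable using (dec-true)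

-- Finite types

-- An input word need not encode any formula, and such words must be rejected, so parsing and
-- evaluation are verified together. The invariant `Completes` asks which formulas could still fill
-- the pending positions, the sum read so far being carried as a function of the structure. Each
-- token turns one instance of it into an equivalent one, and at the end of the input it is decided
-- by inspection of the stacks. Irrelevant subformulas add nothing to the sum but are still read,
-- because their syntax decides membership.
--
-- The obstacle for a finite control is that numerals are unbounded. The index of a connective
-- matters only up to the number of connectives, so it is evaluated with saturation in the control.
-- A variable has to be compared with earlier ones, so a pair (depth, variable) is kept as a word,
-- and each relevant occurrence costs one scan of the set. The depth can be written in unary since
-- it never exceeds the number of letters read.

record Finite (A : Set) : Set where
  field
    size       : ℕ
    index      : A → Fin size
    elem       : Fin size → A
    elem-index : ∀ a → elem (index a) ≡ a

open Finite

finite-Fin : ∀ {n} → Finite (Fin n)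
finite-Fin {n} = record { size = n ; index = id ; elem = id ; elem-index = λ _ → refl }

-- Only `elem ∘ index` has to be the identity, so `size` may overcount; the surplus merely yields
-- machine states and symbols that are never reached.
finite-retract : {A B : Set} → Finite B → (f : A → B) (g : B → A) → (∀ a → g (f a) ≡ a) → Finite A
finite-retract F f g gf = record
  { size = size F ; index = index F ∘ f ; elem = g ∘ elem F
  ; elem-index = λ a → trans (cong g (elem-index F (f a))) (gf a) }

finite-⊤ : Finite ⊤
finite-⊤ = finite-retract (finite-Fin {1}) (λ _ → fzero) (λ _ → tt) (λ _ → refl)

finite-⊎ : {A B : Set} → Finite A → Finite B → Finite (A ⊎ B)
finite-⊎ F G = record
  { size = size F + size G
  ; index = join (size F) (size G) ∘ map⊎ (index F) (index G)
  ; elem = map⊎ (elem F) (elem G) ∘ splitAt (size F)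
  ; elem-index = λ a → trans (cong (map⊎ (elem F) (elem G)) (splitAt-join (size F) (size G) (map⊎ (index F) (index G) a))) (inverse a) }
  where
  inverse : ∀ a → map⊎ (elem F) (elem G) (map⊎ (index F) (index G) a) ≡ a
  inverse (inj₁ a) = cong inj₁ (elem-index F a)
  inverse (inj₂ b) = cong inj₂ (elem-index G b)

finite-Maybe : {A : Set} → Finite A → Finite (Maybe A)
finite-Maybe F = finite-retract (finite-⊎ finite-⊤ F)
  (maybe′ inj₂ (inj₁ tt)) [ (λ _ → nothing) , just ]′ (λ { nothing → refl ; (just _) → refl })

finite-ΣFin : ∀ {n} {P : Fin n → Set} → (∀ i → Finite (P i)) → Finite (Σ (Fin n) P)
finite-ΣFin {zero} G = finite-retract (finite-Fin {0}) proj₁ (λ ()) (λ { (() , _) })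
finite-ΣFin {suc n} {P} G = finite-retract (finite-⊎ (G fzero) (finite-ΣFin {n} {P ∘ fsuc} (G ∘ fsuc)))
  (λ { (fzero , p) → inj₁ p ; (fsuc i , p) → inj₂ (i , p) })
  [ (fzero ,_) , (λ { (i , p) → fsuc i , p }) ]′
  (λ { (fzero , p) → refl ; (fsuc i , p) → refl })

finite-Σ : {A : Set} {P : A → Set} → Finite A → (∀ a → Finite (P a)) → Finite (Σ A P)
finite-Σ {A} {P} F G = finite-retract (finite-ΣFin {size F} {P ∘ elem F} (G ∘ elem F))
  (λ { (a , p) → index F a , subst P (sym (elem-index F a)) p })
  (λ { (i , p) → elem F i , p })
  (λ { (a , p) → transport (elem-index F a) p })
  where
  transport : ∀ {a a′} (e : a′ ≡ a) (p : P a) → (a′ , subst P (sym e) p) ≡ (a , p)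
  transport refl p = refl

finite-× : {A B : Set} → Finite A → Finite B → Finite (A × B)
finite-× F G = finite-Σ F (λ _ → G)

finite-Bool : Finite Bool
finite-Bool = finite-retract (finite-⊎ finite-⊤ finite-⊤)
  (λ { false → inj₁ tt ; true → inj₂ tt }) [ (λ _ → false) , (λ _ → true) ]′ (λ { false → refl ; true → refl })

finite-Vec : {A : Set} → Finite A → ∀ n → Finite (Vec A n)
finite-Vec F zero = finite-retract finite-⊤ (λ _ → tt) (λ _ → []) (λ { [] → refl })
finite-Vec F (suc n) = finite-retract (finite-× F (finite-Vec F n))
  (λ { (a ∷ v) → a , v }) (λ { (a , v) → a ∷ v }) (λ { (a ∷ v) → refl })

-- Stack programs

module StackProgram (m : ℕ) (Label : Set) where

  Reg : Set
  Reg = Fin m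

  Store : Set
  Store = Vec (List Σin) m

  data Code : Set where
    push : Reg → Σin → Code → Code
    pop  : Reg → (Maybe Σin → Code) → Code
    goto : Label → Code
    halt : Bool → Code

  module _ (body : Label → Code) where

    -- Halts t c s b: started on c with store s, the program halts with answer b in at most t steps.
    data Halts : ℕ → Code → Store → Bool → Set where
      halt : ∀ {t s b} → Halts (suc t) (halt b) s b
      push : ∀ {t s b r a c} → Halts t c (updateAt s r (a ∷_)) b → Halts (suc t) (push r a c) s b
      pop  : ∀ {t s b r k} → Halts t (k (head (Vec.lookup s r))) (updateAt s r (drop 1)) b → Halts (suc t) (pop r k) s b
      goto : ∀ {t s b l} → Halts t (body l) s b → Halts (suc t) (goto l) s b

    Halts-mono : ∀ {t t′ c s b} → t ≤ t′ → Halts t c s b → Halts t′ c s b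
    Halts-mono (s≤s _) halt = halt
    Halts-mono (s≤s p) (push x) = push (Halts-mono p x)
    Halts-mono (s≤s p) (pop x) = pop (Halts-mono p x)
    Halts-mono (s≤s p) (goto x) = goto (Halts-mono p x)

    -- A `Code` is a tree that branches over the finite type `Maybe Σin`, so its positions form a
    -- finite type although `Code` itself is not one. The positions in the bodies of the labels
    -- become the control states of the machine.
    Pos : Code → Set
    Pos (push _ _ c) = Maybe (Pos c)
    Pos (pop _ k) = Maybe (Σ (Maybe Σin) (λ x → Pos (k x)))
    Pos (goto _) = ⊤
    Pos (halt _) = ⊤

    finite-Pos : ∀ c → Finite (Pos c)
    finite-Pos (push _ _ c) = finite-Maybe (finite-Pos c)
    finite-Pos (pop _ k) = finite-Maybe (finite-Σ (finite-Maybe finite-Fin) (λ x → finite-Pos (k x)))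
    finite-Pos (goto _) = finite-⊤
    finite-Pos (halt _) = finite-⊤

    root : ∀ c → Pos c
    root (push _ _ _) = nothing
    root (pop _ _) = nothing
    root (goto _) = tt
    root (halt _) = tt

    Node : Set
    Node = Σ Label (λ l → Pos (body l))

    entry : Label → Node
    entry l = l , root (body l)

    data Instr : Set where
      push : Reg → Σin → Node → Instr
      pop  : Reg → Instr
      jump : Node → Instr
      halt : Bool → Instr

    instrAt : ∀ c → (Pos c → Node) → Pos c → Instr
    instrAt (push r a c) emb nothing = push r a (emb (just (root c)))
    instrAt (push r a c) emb (just p) = instrAt c (emb ∘ just) p
    instrAt (pop r k) emb nothing = pop r
    instrAt (pop r k) emb (just (x , p)) = instrAt (k x) (λ p′ → emb (just (x , p′))) p
    instrAt (goto l) emb _ = jump (entry l)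
    instrAt (halt b) emb _ = halt b

    contAt : ∀ c → (Pos c → Node) → Pos c → Maybe Σin → Node
    contAt (push r a c) emb nothing _ = emb nothing
    contAt (push r a c) emb (just p) y = contAt c (emb ∘ just) p y
    contAt (pop r k) emb nothing y = emb (just (y , root (k y)))
    contAt (pop r k) emb (just (x , p)) y = contAt (k x) (λ p′ → emb (just (x , p′))) p y
    contAt (goto l) emb p _ = emb p
    contAt (halt b) emb p _ = emb p

    instr : Node → Instr
    instr (l , p) = instrAt (body l) (l ,_) p

    cont : Node → Maybe Σin → Node
    cont (l , p) = contAt (body l) (l ,_) p

    -- Ties a control state to the code that remains to be run from it, through what `instr` and
    -- `cont` yield there. The simulation can then recurse on `Halts` without extracting subtrees at
    -- positions.
    data Implements : Node → Code → Set where
      push : ∀ {q q′ r a c} → instr q ≡ push r a q′ → Implements q′ c → Implements q (push r a c)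
      pop  : ∀ {q r k} → instr q ≡ pop r → (∀ x → Implements (cont q x) (k x)) → Implements q (pop r k)
      goto : ∀ {q l} → instr q ≡ jump (entry l) → Implements q (goto l)
      halt : ∀ {q b} → instr q ≡ halt b → Implements q (halt b)

    -- The embedding `emb` is arbitrary because the induction descends into subtrees, whose
    -- positions enter the whole tree through a composite of constructors.
    implements-root : ∀ c (emb : Pos c → Node) → (∀ p → instr (emb p) ≡ instrAt c emb p) →
      (∀ p y → cont (emb p) y ≡ contAt c emb p y) → Implements (emb (root c)) c
    implements-root (push r a c) emb i k =
      push (i nothing) (implements-root c (emb ∘ just) (i ∘ just) (k ∘ just))
    implements-root (pop r c) emb i k = pop (i nothing) λ x →
      subst (λ q → Implements q (c x)) (sym (k nothing x))
        (implements-root (c x) (λ p → emb (just (x , p))) (λ p → i (just (x , p))) (λ p → k (just (x , p))))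
    implements-root (goto l) emb i k = goto (i tt)
    implements-root (halt b) emb i k = halt (i tt)

    implements-entry : ∀ l → Implements (entry l) (body l)
    implements-entry l = implements-root (body l) (l ,_) (λ _ → refl) (λ _ _ → refl)

-- One-tape simulation

-- The stacks are the tracks of the tape, all with their tops in the origin cell, so a push or a pop
-- shifts one track by one cell.  Cell −1 stays empty and stops the head on its way back.
module Simulation (m-1 : ℕ) {Label : Set} (finite-Label : Finite Label)
  (body : Label → StackProgram.Code (suc m-1) Label) (start : Label) where

  m : ℕ
  m = suc m-1

  open StackProgram m Label

  Cell : Set
  Cell = Vec (Maybe Σin) m

  data Phase : Set where
    exec    : Node body → Phase
    pushing : Reg → Σin → Node body → Phase
    back    : Reg → Node body → Phase
    seek    : Reg → Node body → Phase
    pull    : Reg → Maybe Σin → Node body → Phase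

  Action : Set
  Action = (Phase ⊎ Bool) × Cell × Move

  perform : Instr body → Node body → Cell → Action
  perform (push r a q′) q c = inj₁ (pushing r a q′) , c , stay
  perform (pop r) q c = inj₁ (seek r q) , c , stay
  perform (jump q′) q c = inj₁ (exec q′) , c , stay
  perform (halt b) q c = inj₂ b , c , stay

  -- A push carries a letter outwards, exchanging it in each cell for the letter that it displaces.
  -- A pop walks to the first empty cell of the track and shifts the letters on the way back; the
  -- last letter carried is the old top, and at cell -1 it selects the continuation.
  act : Phase → Cell → Action
  act (exec q) c = perform (instr body q) q c
  act (pushing r a q) c = case-top (Vec.lookup c r)
    where
    case-top : Maybe Σin → Action
    case-top nothing = inj₁ (back r q) , c [ r ]≔ just a , left
    case-top (just y) = inj₁ (pushing r y q) , c [ r ]≔ just a , right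
  act (back r q) c = case-top (Vec.lookup c r)
    where
    case-top : Maybe Σin → Action
    case-top nothing = inj₁ (exec q) , c , right
    case-top (just _) = inj₁ (back r q) , c , left
  act (seek r q) c = case-top (Vec.lookup c r)
    where
    case-top : Maybe Σin → Action
    case-top nothing = inj₁ (pull r nothing q) , c , left
    case-top (just _) = inj₁ (seek r q) , c , right
  act (pull r x q) c = case-top (Vec.lookup c r)
    where
    case-top : Maybe Σin → Action
    case-top nothing = inj₁ (exec (cont body q x)) , c , right
    case-top (just y) = inj₁ (pull r (just y) q) , c [ r ]≔ x , left

  finite-Cell : Finite Cell
  finite-Cell = finite-Vec (finite-Maybe finite-Fin) m

  finite-Node : Finite (Node body)
  finite-Node = finite-Σ finite-Label (λ l → finite-Pos body (body l))

  finite-Phase : Finite Phase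
  finite-Phase = finite-retract
    (finite-⊎ finite-Node (finite-⊎ (finite-× (finite-Fin {m}) (finite-× (finite-Fin {6}) finite-Node))
      (finite-⊎ (finite-× (finite-Fin {m}) finite-Node) (finite-⊎ (finite-× (finite-Fin {m}) finite-Node)
        (finite-× (finite-Fin {m}) (finite-× (finite-Maybe (finite-Fin {6})) finite-Node))))))
    (λ { (exec q) → inj₁ q ; (pushing r a q) → inj₂ (inj₁ (r , a , q)) ; (back r q) → inj₂ (inj₂ (inj₁ (r , q)))
       ; (seek r q) → inj₂ (inj₂ (inj₂ (inj₁ (r , q)))) ; (pull r x q) → inj₂ (inj₂ (inj₂ (inj₂ (r , x , q)))) })
    (λ { (inj₁ q) → exec q ; (inj₂ (inj₁ (r , a , q))) → pushing r a q ; (inj₂ (inj₂ (inj₁ (r , q)))) → back r q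
       ; (inj₂ (inj₂ (inj₂ (inj₁ (r , q))))) → seek r q ; (inj₂ (inj₂ (inj₂ (inj₂ (r , x , q))))) → pull r x q })
    (λ { (exec q) → refl ; (pushing r a q) → refl ; (back r q) → refl ; (seek r q) → refl ; (pull r x q) → refl })

  module OneTape (finite-Cell : Finite Cell) (finite-Phase : Finite Phase) where

    Symbol : Set
    Symbol = Fin (7 + size finite-Cell)

    emptyCell : Cell
    emptyCell = Vec.replicate m nothing

    -- The seven prescribed symbols are read as cells too, an input letter being a cell with only
    -- track zero filled. The initial tape therefore represents the initial store as it is, without
    -- a translating pass.
    rawCell : Fin 7 → Cell
    rawCell fzero = emptyCell
    rawCell (fsuc a) = just a ∷ Vec.replicate m-1 nothing

    cell : Symbol → Cell
    cell g = [ rawCell , elem finite-Cell ]′ (splitAt 7 g)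

    symbol : Cell → Symbol
    symbol c = 7 ↑ʳ index finite-Cell c

    cell-symbol : ∀ c → cell (symbol c) ≡ c
    cell-symbol c = elem-index finite-Cell c

    outcome : Action → (Fin (size finite-Phase) ⊎ Bool) × Symbol × Move
    outcome (o , c , mv) = map⊎₁ (index finite-Phase) o , symbol c , mv

    machine : TM
    machine = record
      { nQ = size finite-Phase ; k = size finite-Cell ; start = index finite-Phase (exec (entry body start))
      ; δ = λ q g → outcome (act (elem finite-Phase q) (cell g)) }

    Tape : Set
    Tape = List Symbol × Symbol × List Symbol

    record At (p : Phase) (tape : Tape) (t : ℕ) (b : Bool) : Set where
      constructor at
      field
        halts : run machine t (conf (index finite-Phase p) (proj₁ tape) (proj₁ (proj₂ tape)) (proj₂ (proj₂ tape))) ≡ inj₂ b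

    open At

    run-mono : ∀ {t t′ c b} → t ≤ t′ → run machine t c ≡ inj₂ b → run machine t′ c ≡ inj₂ b
    run-mono {t′ = zero} z≤n e = e
    run-mono {t′ = suc t′} z≤n ()
    run-mono {suc t} {suc t′} {c} (s≤s p) e with step machine c
    ... | inj₁ c′ = run-mono p e
    ... | inj₂ b = e

    tick : ∀ {p p′ c mv l h r t b} → act p (cell h) ≡ (inj₁ p′ , c , mv) →
      At p′ (moveHead machine mv l (symbol c) r) t b → At p (l , h , r) (suc t) b
    tick {p} {p′} {c} {mv} {l} {h} {r} {t} {b} e (at x) = at halts′
      where
      halts′ : run machine (suc t) (conf (index finite-Phase p) l h r) ≡ inj₂ b
      halts′ rewrite elem-index finite-Phase p | e = x

    tick-halt : ∀ {p c mv l h r t b} → act p (cell h) ≡ (inj₂ b , c , mv) → At p (l , h , r) (suc t) b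
    tick-halt {p} {c} {mv} {l} {h} {r} {t} {b} e = at halts′
      where
      halts′ : run machine (suc t) (conf (index finite-Phase p) l h r) ≡ inj₂ b
      halts′ rewrite elem-index finite-Phase p | e = refl

    At-mono : ∀ {p tape t t′ b} → t ≤ t′ → At p tape t b → At p tape t′ b
    At-mono le (at e) = at (run-mono le e)

    At-cast : ∀ {p tape t t′ b} → t ≡ t′ → At p tape t b → At p tape t′ b
    At-cast refl x = x

    data Track (r : Reg) : List Σin → List Symbol → Set where
      nil  : ∀ {gs} → All (λ g → Vec.lookup (cell g) r ≡ nothing) gs → Track r [] gs
      cons : ∀ {a as g gs} → Vec.lookup (cell g) r ≡ just a → Track r as gs → Track r (a ∷ as) (g ∷ gs)

    OtherTracks : Reg → List Symbol → List Symbol → Set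
    OtherTracks r gs gs′ = ∀ r′ → r′ ≢ r → ∀ as → Track r′ as gs → Track r′ as gs′

    Blanks : List Symbol → Set
    Blanks = All (λ g → cell g ≡ emptyCell)

    Track-retop : ∀ {r gs g} as → Vec.lookup (cell g) r ≡ head as → Track r (drop 1 as) gs → Track r as (g ∷ gs)
    Track-retop [] e (nil ps) = nil (e ∷ ps)
    Track-retop (a ∷ as) e tr = cons e tr

    OtherTracks-cons : ∀ {r g g′ gs gs′} → (∀ r′ → r′ ≢ r → Vec.lookup (cell g′) r′ ≡ Vec.lookup (cell g) r′) →
      OtherTracks r gs gs′ → OtherTracks r (g ∷ gs) (g′ ∷ gs′)
    OtherTracks-cons e o r′ ne .[] (nil (p ∷ ps)) with o r′ ne [] (nil ps)
    ... | nil ps′ = nil (trans (e r′ ne) p ∷ ps′)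
    OtherTracks-cons e o r′ ne .(_ ∷ _) (cons p tr) = cons (trans (e r′ ne) p) (o r′ ne _ tr)

    OtherTracks-refl : ∀ {r gs} → OtherTracks r gs gs
    OtherTracks-refl r′ ne as tr = tr

    OtherTracks-trans : ∀ {r gs gs′ gs″} → OtherTracks r gs gs′ → OtherTracks r gs′ gs″ → OtherTracks r gs gs″
    OtherTracks-trans o o′ r′ ne as tr = o′ r′ ne as (o r′ ne as tr)

    cell-≔ : ∀ c r x r′ → r′ ≢ r → Vec.lookup (cell (symbol (c [ r ]≔ x))) r′ ≡ Vec.lookup c r′
    cell-≔ c r x r′ ne rewrite cell-symbol (c [ r ]≔ x) = lookup∘update′ ne c x

    cell-≔-same : ∀ c r x → Vec.lookup (cell (symbol (c [ r ]≔ x))) r ≡ x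
    cell-≔-same c r x rewrite cell-symbol (c [ r ]≔ x) = lookup∘update r c x

    lookup-cell-symbol : ∀ g r → Vec.lookup (cell (symbol (cell g))) r ≡ Vec.lookup (cell g) r
    lookup-cell-symbol g r = cong (λ c → Vec.lookup c r) (cell-symbol (cell g))

    lookup-empty : ∀ {g} r → cell g ≡ emptyCell → Vec.lookup (cell g) r ≡ nothing
    lookup-empty r e rewrite e = lookup-replicate r nothing

    extend : List Symbol → Symbol × List Symbol
    extend [] = blank machine , []
    extend (g ∷ gs) = g , gs

    uncurry-∷ : Symbol × List Symbol → List Symbol
    uncurry-∷ (g , gs) = g ∷ gs

    moveRight : ∀ l h rs → moveHead machine right l h rs ≡ (h ∷ l , extend rs)
    moveRight l h [] = refl
    moveRight l h (g ∷ rs) = refl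

    Track-extend : ∀ {r as} rs → Track r as rs → Track r as (uncurry-∷ (extend rs))
    Track-extend {r} [] (nil []) = nil (lookup-replicate r nothing ∷ [])
    Track-extend (g ∷ rs) tr = tr

    -- Stated for an arbitrary starting cell and for whatever happens once the head returns to its
    -- left neighbour, so that the walk beyond each cell is a nested instance. Every letter costs
    -- one step out and one step back.
    pushing-run : ∀ as l h rs r x q → Track r as (h ∷ rs) → ∃ λ h′ → ∃ λ rs′ →
      Track r (x ∷ as) (h′ ∷ rs′) × OtherTracks r (h ∷ rs) (h′ ∷ rs′) ×
      (∀ t b → At (back r q) (moveHead machine left l h′ rs′) t b → At (pushing r x q) (l , h , rs) (length as * 2 + suc t) b)
    pushing-run [] l h rs r x q (nil (p ∷ ps)) =
      symbol (cell h [ r ]≔ just x) , rs , cons (cell-≔-same (cell h) r (just x)) (nil ps) ,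
      OtherTracks-cons (cell-≔ (cell h) r (just x)) OtherTracks-refl ,
      λ t b done → tick {pushing r x q} {l = l} {h} {rs} {t} acts done
      where
      acts : act (pushing r x q) (cell h) ≡ (inj₁ (back r q) , cell h [ r ]≔ just x , left)
      acts rewrite p = refl
    pushing-run (y ∷ as) l h rs r x q (cons p tr)
      with pushing-run as (symbol (cell h [ r ]≔ just x) ∷ l) (proj₁ (extend rs)) (proj₂ (extend rs)) r y q (Track-extend rs tr)
    ... | h₂ , rs₂ , tr₂ , others , runs =
      -- The cell is written on the way out and copied unchanged on the way back, hence the nested
      -- recoding.
      symbol (cell (symbol (cell h [ r ]≔ just x))) , h₂ ∷ rs₂ ,
      cons (trans (lookup-cell-symbol (symbol (cell h [ r ]≔ just x)) r) (cell-≔-same (cell h) r (just x))) tr₂ ,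
      OtherTracks-cons
        (λ r′ ne → trans (lookup-cell-symbol (symbol (cell h [ r ]≔ just x)) r′) (cell-≔ (cell h) r (just x) r′ ne))
        (OtherTracks-trans (λ _ _ _ → Track-extend rs) others) ,
      λ t b done → tick {pushing r x q} {l = l} {h} {rs} acts
        (subst (λ tape → At (pushing r y q) tape _ b) (sym (moveRight l _ rs))
          (At-cast (+-suc (length as * 2) (suc t))
            (runs (suc t) b (tick {back r q} {l = l} {symbol (cell h [ r ]≔ just x)} {h₂ ∷ rs₂} returns done))))
      where
      acts : act (pushing r x q) (cell h) ≡ (inj₁ (pushing r y q) , cell h [ r ]≔ just x , right)
      acts rewrite p = refl
      returns : act (back r q) (cell (symbol (cell h [ r ]≔ just x))) ≡
        (inj₁ (back r q) , cell (symbol (cell h [ r ]≔ just x)) , left)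
      returns rewrite cell-≔-same (cell h) r (just x) = refl

    -- The counterpart for a pop: nothing changes on the way out, and on the way back each cell
    -- receives `head as`, the letter of its right neighbour, and hands its own letter to the left.
    seek-run : ∀ as l h rs r q → Track r as (h ∷ rs) → ∃ λ h′ → ∃ λ rs′ →
      Track r (drop 1 as) (h′ ∷ rs′) × OtherTracks r (h ∷ rs) (h′ ∷ rs′) ×
      (∀ t b → At (pull r (head as) q) (moveHead machine left l h′ rs′) t b → At (seek r q) (l , h , rs) (length as * 2 + suc t) b)
    seek-run [] l h rs r q (nil (p ∷ ps)) =
      symbol (cell h) , rs , nil (trans (lookup-cell-symbol h r) p ∷ ps) ,
      OtherTracks-cons (λ r′ _ → lookup-cell-symbol h r′) OtherTracks-refl ,
      λ t b done → tick {seek r q} {l = l} {h} {rs} {t} acts done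
      where
      acts : act (seek r q) (cell h) ≡ (inj₁ (pull r nothing q) , cell h , left)
      acts rewrite p = refl
    seek-run (y ∷ as) l h rs r q (cons p tr)
      with seek-run as (symbol (cell h) ∷ l) (proj₁ (extend rs)) (proj₂ (extend rs)) r q (Track-extend rs tr)
    ... | h₂ , rs₂ , tr₂ , others , runs =
      symbol (h₁ [ r ]≔ head as) , h₂ ∷ rs₂ ,
      Track-retop as (cell-≔-same h₁ r (head as)) tr₂ ,
      OtherTracks-cons
        (λ r′ ne → trans (cell-≔ h₁ r (head as) r′ ne) (lookup-cell-symbol h r′))
        (OtherTracks-trans (λ _ _ _ → Track-extend rs) others) ,
      λ t b done → tick {seek r q} {l = l} {h} {rs} acts
        (subst (λ tape → At (seek r q) tape _ b) (sym (moveRight l _ rs))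
          (At-cast (+-suc (length as * 2) (suc t))
            (runs (suc t) b (tick {pull r (head as) q} {l = l} {symbol (cell h)} {h₂ ∷ rs₂} returns done))))
      where
      h₁ : Cell
      h₁ = cell (symbol (cell h))
      acts : act (seek r q) (cell h) ≡ (inj₁ (seek r q) , cell h , right)
      acts rewrite p = refl
      returns : act (pull r (head as) q) h₁ ≡ (inj₁ (pull r (just y) q) , h₁ [ r ]≔ head as , left)
      returns rewrite trans (lookup-cell-symbol h r) p = refl

    Represents : Store → Tape → Set
    Represents s (l , h , rs) = Blanks l × (∀ r → Track r (Vec.lookup s r) (h ∷ rs))

    represents-update : ∀ {s l l′ h rs h′ rs′ r f} → Represents s (l , h , rs) → Blanks l′ →
      Track r (f (Vec.lookup s r)) (h′ ∷ rs′) → OtherTracks r (h ∷ rs) (h′ ∷ rs′) →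
      Represents (updateAt s r f) (l′ , h′ , rs′)
    represents-update {s} {h′ = h′} {rs′} {r} {f} (_ , tracks) bl tr others = bl , track
      where
      track : ∀ r′ → Track r′ (Vec.lookup (updateAt s r f) r′) (h′ ∷ rs′)
      track r′ with r′ ≟ᶠ r
      ... | yes refl rewrite lookup∘updateAt r {f} s = tr
      ... | no ne rewrite lookup∘updateAt′ r′ r {f} ne s = others r′ ne _ (tracks r′)

    -- From cell −1, one move to the right returns to the origin.
    leave-left-end : ∀ {p q} l h rs → Blanks l →
      (∀ g → cell g ≡ emptyCell → act p (cell g) ≡ (inj₁ (exec q) , cell g , right)) →
      ∃ λ l′ → Blanks l′ × (∀ t b → At (exec q) (l′ , h , rs) t b → At p (moveHead machine left l h rs) (suc t) b)
    leave-left-end {p} [] h rs [] acts = symbol (cell (blank machine)) ∷ [] , cell-symbol _ ∷ [] ,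
      λ t b → tick {p} {l = []} {blank machine} {h ∷ rs} {t} (acts (blank machine) refl)
    leave-left-end {p} (g ∷ l) h rs (e ∷ bl) acts = symbol (cell g) ∷ l , trans (cell-symbol _) e ∷ bl ,
      λ t b → tick {p} {l = l} {g} {h ∷ rs} {t} (acts g e)

    -- One step to dispatch the instruction, two for each letter of the track, one to turn round at
    -- its end and one to leave cell -1.
    cost : ℕ → ℕ
    cost H = H * 2 + 3

    length-drop-1 : (xs : List Σin) → length (drop 1 xs) ≤ length xs
    length-drop-1 [] = z≤n
    length-drop-1 (x ∷ xs) = n≤1+n (length xs)

    -- The time left is charged in advance: a step adds at most one letter to a stack, so height
    -- plus remaining time never grows and `H` stays fixed throughout the simulation.
    HeightBound : Store → ℕ → ℕ → Set
    HeightBound s t H = ∀ r → length (Vec.lookup s r) + t ≤ H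

    heights-mono : ∀ {s t H} → HeightBound s (suc t) H → HeightBound s t H
    heights-mono b r = ≤-trans (+-monoʳ-≤ _ (n≤1+n _)) (b r)

    heights-update : ∀ {s t H} r f → (∀ xs → length {A = Σin} (f xs) ≤ suc (length xs)) →
      HeightBound s (suc t) H → HeightBound (updateAt s r f) t H
    heights-update {s} {t} r f le b r′ with r′ ≟ᶠ r
    ... | yes refl rewrite lookup∘updateAt r {f} s =
      ≤-trans (+-monoˡ-≤ t (le (Vec.lookup s r))) (≤-trans (≤-reflexive (sym (+-suc _ t))) (b r))
    ... | no ne rewrite lookup∘updateAt′ r′ r {f} ne s = heights-mono {s} b r′

    operation-cost : ∀ {n H} t → n ≤ H → suc (n * 2 + suc (suc t)) ≤ cost H + t
    operation-cost {n} {H} t le = begin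
      suc (n * 2 + suc (suc t)) ≡⟨ cong suc (trans (+-suc (n * 2) (suc t)) (cong suc (+-suc (n * 2) t))) ⟩
      3 + (n * 2 + t)           ≤⟨ +-monoʳ-≤ 3 (+-monoˡ-≤ t (*-monoˡ-≤ 2 le)) ⟩
      3 + (H * 2 + t)           ≡⟨ sym (+-assoc 3 (H * 2) t) ⟩
      3 + H * 2 + t             ≡⟨ cong (_+ t) (+-comm 3 (H * 2)) ⟩
      cost H + t                ∎
      where open ≤-Reasoning

    -- Writing back an unchanged cell may still change the symbol, because an input letter or a
    -- blank is replaced by the code of the same cell.
    represents-rewrite : ∀ {s l h rs} → Represents s (l , h , rs) → Represents s (l , symbol (cell h) , rs)
    represents-rewrite {s} {l} {h} {rs} (bl , tracks) = bl , λ r → retrack (tracks r)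
      where
      retrack : ∀ {r as} → Track r as (h ∷ rs) → Track r as (symbol (cell h) ∷ rs)
      retrack {r} (nil (p ∷ ps)) = nil (trans (lookup-cell-symbol h r) p ∷ ps)
      retrack {r} (cons p tr) = cons (trans (lookup-cell-symbol h r) p) tr

    1≤cost : ∀ H → 1 ≤ cost H
    1≤cost H = ≤-trans (s≤s z≤n) (m≤n+m 3 (H * 2))

    simulate : ∀ {t c s b q l h rs} H → Halts body t c s b → Implements body q c → Represents s (l , h , rs) →
      HeightBound s t H → At (exec q) (l , h , rs) (t * cost H) b
    simulate {suc t} {q = q} {l} {h} {rs} H halt (halt e) rep hb =
      At-mono (≤-trans (1≤cost H) (m≤m+n (cost H) (t * cost H)))
        (tick-halt {exec q} {l = l} {h} {rs} {0} (cong (λ i → perform i q (cell h)) e))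
    simulate {suc t} {s = s} {b = b} {q} {l} {h} {rs} H (goto {l = lbl} x) (goto e) rep hb =
      At-mono (+-monoˡ-≤ (t * cost H) (1≤cost H))
        (tick {exec q} {l = l} {h} {rs} {t * cost H} (cong (λ i → perform i q (cell h)) e)
          (simulate H x (implements-entry body lbl) (represents-rewrite {s} rep) (heights-mono {s} hb)))
    simulate {suc t} {s = s} {b = b} {q} {l} {h} {rs} H (push {r = r} {a} x) (push {q′ = q′} e i) rep hb
      with pushing-run (Vec.lookup s r) l (symbol (cell h)) rs r a q′ (proj₂ (represents-rewrite {s} rep) r)
    ... | h′ , rs′ , tr , others , runs
      with leave-left-end {back r q′} {q′} l h′ rs′ (proj₁ rep) acts
      where
      acts : ∀ g → cell g ≡ emptyCell → act (back r q′) (cell g) ≡ (inj₁ (exec q′) , cell g , right)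
      acts g e rewrite lookup-empty {g} r e = refl
    ... | l′ , bl′ , leave =
      At-mono (operation-cost (t * cost H) (m+n≤o⇒m≤o (length (Vec.lookup s r)) (hb r)))
        (tick {exec q} {l = l} {h} {rs} (cong (λ i → perform i q (cell h)) e)
          (runs _ b (leave _ b (simulate H x i
            (represents-update {s} (represents-rewrite {s} rep) bl′ tr others)
            (heights-update {s} r (a ∷_) (λ _ → ≤-refl) hb)))))
    simulate {suc t} {s = s} {b = b} {q} {l} {h} {rs} H (pop {r = r} x) (pop e i) rep hb
      with seek-run (Vec.lookup s r) l (symbol (cell h)) rs r q (proj₂ (represents-rewrite {s} rep) r)
    ... | h′ , rs′ , tr , others , runs
      with leave-left-end {pull r (head (Vec.lookup s r)) q} {cont body q (head (Vec.lookup s r))} l h′ rs′ (proj₁ rep) acts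
      where
      acts : ∀ g → cell g ≡ emptyCell → act (pull r (head (Vec.lookup s r)) q) (cell g) ≡
        (inj₁ (exec (cont body q (head (Vec.lookup s r)))) , cell g , right)
      acts g e rewrite lookup-empty {g} r e = refl
    ... | l′ , bl′ , leave =
      At-mono (operation-cost (t * cost H) (m+n≤o⇒m≤o (length (Vec.lookup s r)) (hb r)))
        (tick {exec q} {l = l} {h} {rs} (cong (λ i → perform i q (cell h)) e)
          (runs _ b (leave _ b (simulate H x (i (head (Vec.lookup s r)))
            (represents-update {s} (represents-rewrite {s} rep) bl′ tr others)
            (heights-update {s} r (drop 1) (λ xs → ≤-trans (length-drop-1 xs) (n≤1+n _)) hb)))))

    inputStore : List Σin → Store
    inputStore w = w ∷ Vec.replicate m-1 []

    cell-inSym : ∀ a → cell (inSym machine a) ≡ just a ∷ Vec.replicate m-1 nothing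
    cell-inSym a rewrite splitAt-↑ˡ 6 a (size finite-Cell) = refl

    input-track₀ : ∀ w → Track fzero w (map (inSym machine) w)
    input-track₀ [] = nil []
    input-track₀ (a ∷ w) = cons (cong (λ c → Vec.lookup c fzero) (cell-inSym a)) (input-track₀ w)

    input-track₊ : ∀ r w → Track (fsuc r) [] (map (inSym machine) w)
    input-track₊ r w = nil (empties w)
      where
      empties : ∀ w → All (λ g → Vec.lookup (cell g) (fsuc r) ≡ nothing) (map (inSym machine) w)
      empties [] = []
      empties (a ∷ w) = trans (cong (λ c → Vec.lookup c (fsuc r)) (cell-inSym a)) (lookup-replicate r nothing) ∷ empties w

    initial-represents : ∀ w → Represents (inputStore w) ([] , extend (map (inSym machine) w))
    initial-represents w = [] , tracks
      where
      tracks : ∀ r → Track r (Vec.lookup (inputStore w) r) (uncurry-∷ (extend (map (inSym machine) w)))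
      tracks fzero = Track-extend _ (input-track₀ w)
      tracks (fsuc r) rewrite lookup-replicate {n = m-1} {A = List Σin} r [] = Track-extend _ (input-track₊ r w)

    initial-conf : ∀ w → initConf machine w ≡
      conf (TM.start machine) [] (proj₁ (extend (map (inSym machine) w))) (proj₂ (extend (map (inSym machine) w)))
    initial-conf [] = refl
    initial-conf (_ ∷ _) = refl

    initial-heights : ∀ w t → HeightBound (inputStore w) t (length w + t)
    initial-heights w t fzero = ≤-refl
    initial-heights w t (fsuc r) rewrite lookup-replicate {n = m-1} {A = List Σin} r [] = m≤n+m t (length w)

    machine-halts : ∀ {w t b} → Halts body t (body start) (inputStore w) b →
      run machine (t * cost (length w + t)) (initConf machine w) ≡ inj₂ b
    machine-halts {w} {t} x rewrite initial-conf w =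
      halts (simulate (length w + t) x (implements-entry body start) (initial-represents w) (initial-heights w t))

-- The alphabet and the keys

linearAt : ∀ {B} → All IsLinear B → ∀ j → IsLinear (List.lookup B j)
linearAt (p ∷ ps) fzero = p
linearAt (p ∷ ps) (fsuc j) = linearAt ps j

pattern σ0 = fzero
pattern σ1 = fsuc fzero
pattern σV = fsuc (fsuc fzero)
pattern σX = fsuc (fsuc (fsuc fzero))
pattern σC = fsuc (fsuc (fsuc (fsuc fzero)))
pattern σE = fsuc (fsuc (fsuc (fsuc (fsuc fzero))))

digit : Bool → Σin
digit false = s0
digit true = s1

isE : Σin → Bool
isE σE = true
isE _ = false

eqSym : Σin → Σin → Bool
eqSym a b = does (a ≟ᶠ b)

eqWord : List Σin → List Σin → Bool
eqWord [] [] = true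
eqWord [] (_ ∷ _) = false
eqWord (_ ∷ _) [] = false
eqWord (a ∷ as) (b ∷ bs) = eqSym a b ∧ eqWord as bs

eqSym-refl : ∀ a → eqSym a a ≡ true
eqSym-refl a = dec-true (a ≟ᶠ a) refl

eqSym⇒≡ : ∀ a b → eqSym a b ≡ true → a ≡ b
eqSym⇒≡ a b e with a ≟ᶠ b
... | yes p = p

eqWord⇒≡ : ∀ as bs → eqWord as bs ≡ true → as ≡ bs
eqWord⇒≡ [] [] e = refl
eqWord⇒≡ (a ∷ as) (b ∷ bs) e with eqSym a b in ab
... | true = cong₂ _∷_ (eqSym⇒≡ a b ab) (eqWord⇒≡ as bs e)

Letters : List Σin → Set
Letters = All (λ a → isE a ≡ false)

All-ʳ++ : ∀ {P : Σin → Set} {xs ys} → All P xs → All P ys → All P (xs ʳ++ ys)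
All-ʳ++ [] qs = qs
All-ʳ++ (p ∷ ps) qs = All-ʳ++ ps (p ∷ qs)

numeral : List Bool → ℕ
numeral = foldr (λ b n → if b then 2 * suc n else suc (2 * n)) 0

bits : ℕᵇ → List Bool
bits bzero = []
bits 1+[2 x ] = false ∷ bits x
bits 2[1+ x ] = true ∷ bits x

unbits : List Bool → ℕᵇ
unbits [] = bzero
unbits (false ∷ ds) = 1+[2 unbits ds ]
unbits (true ∷ ds) = 2[1+ unbits ds ]

bits-unbits : ∀ ds → bits (unbits ds) ≡ ds
bits-unbits [] = refl
bits-unbits (false ∷ ds) = cong (false ∷_) (bits-unbits ds)
bits-unbits (true ∷ ds) = cong (true ∷_) (bits-unbits ds)

digits-bits : ∀ x → map digit (bits x) ≡ binDigits x
digits-bits bzero = refl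
digits-bits 1+[2 x ] = cong (s0 ∷_) (digits-bits x)
digits-bits 2[1+ x ] = cong (s1 ∷_) (digits-bits x)

numeral-bits : ∀ x → numeral (bits x) ≡ fromBin x
numeral-bits bzero = refl
numeral-bits 1+[2 x ] = cong (λ n → suc (2 * n)) (numeral-bits x)
numeral-bits 2[1+ x ] = cong (λ n → 2 * suc n) (numeral-bits x)

bitsℕ : ℕ → List Bool
bitsℕ = bits ∘ toBin

encℕ-bits : ∀ n → encℕ n ≡ map digit (bitsℕ n)
encℕ-bits n = sym (digits-bits (toBin n))

numeral-bitsℕ : ∀ n → numeral (bitsℕ n) ≡ n
numeral-bitsℕ n = trans (numeral-bits (toBin n)) (fromBin-toBin n)

-- Bijective numeration has no leading zeros: every digit string is the numeral of exactly one
-- number, so the parser never has to reject one.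
bitsℕ-numeral : ∀ ds → bitsℕ (numeral ds) ≡ ds
bitsℕ-numeral ds = begin
  bits (toBin (numeral ds))                 ≡⟨ cong (λ es → bits (toBin (numeral es))) (sym (bits-unbits ds)) ⟩
  bits (toBin (numeral (bits (unbits ds)))) ≡⟨ cong (bits ∘ toBin) (numeral-bits (unbits ds)) ⟩
  bits (toBin (fromBin (unbits ds)))        ≡⟨ cong bits (toBin-fromBin (unbits ds)) ⟩
  bits (unbits ds)                          ≡⟨ bits-unbits ds ⟩
  ds                                        ∎
  where open ≡-Reasoning

encℕ-numeral : ∀ ds → encℕ (numeral ds) ≡ map digit ds
encℕ-numeral ds = trans (encℕ-bits (numeral ds)) (cong (map digit) (bitsℕ-numeral ds))

-- No digit string followed by sE is a proper prefix of another.
digits-unique : ∀ ds es {u v} → map digit ds ++ sE ∷ u ≡ map digit es ++ sE ∷ v → ds ≡ es × u ≡ v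
digits-unique [] [] refl = refl , refl
digits-unique [] (false ∷ es) ()
digits-unique [] (true ∷ es) ()
digits-unique (false ∷ ds) [] ()
digits-unique (true ∷ ds) [] ()
digits-unique (false ∷ ds) (false ∷ es) e with digits-unique ds es (∷-injectiveʳ e)
... | refl , q = refl , q
digits-unique (true ∷ ds) (true ∷ es) e with digits-unique ds es (∷-injectiveʳ e)
... | refl , q = refl , q

encℕ-unique : ∀ n ds {u v} → encℕ n ++ sE ∷ u ≡ map digit ds ++ sE ∷ v → n ≡ numeral ds × u ≡ v
encℕ-unique n ds e with digits-unique (bitsℕ n) ds (trans (cong (_++ sE ∷ _) (sym (encℕ-bits n))) e)
... | p , q = trans (sym (numeral-bitsℕ n)) (cong numeral p) , q

data Stuck : List Σin → Set where
  end  : Stuck []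
  atV  : ∀ w → Stuck (sV ∷ w)
  atX  : ∀ w → Stuck (sX ∷ w)
  atC  : ∀ w → Stuck (sC ∷ w)

data DigitView : List Σin → Set where
  terminated : ∀ ds w → DigitView (map digit ds ++ sE ∷ w)
  stuck      : ∀ ds {w} → Stuck w → DigitView (map digit ds ++ w)

digitView : ∀ w → DigitView w
digitView [] = stuck [] end
digitView (σV ∷ w) = stuck [] (atV w)
digitView (σX ∷ w) = stuck [] (atX w)
digitView (σC ∷ w) = stuck [] (atC w)
digitView (σE ∷ w) = terminated [] w
digitView (σ0 ∷ w) with digitView w
... | terminated ds w′ = terminated (false ∷ ds) w′
... | stuck ds st = stuck (false ∷ ds) st
digitView (σ1 ∷ w) with digitView w
... | terminated ds w′ = terminated (true ∷ ds) w′
... | stuck ds st = stuck (true ∷ ds) st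

stuck-unterminated : ∀ ds es {w u} → Stuck w → map digit ds ++ w ≢ map digit es ++ sE ∷ u
stuck-unterminated [] [] end ()
stuck-unterminated [] [] (atV w) ()
stuck-unterminated [] [] (atX w) ()
stuck-unterminated [] [] (atC w) ()
stuck-unterminated [] (false ∷ es) end ()
stuck-unterminated [] (false ∷ es) (atV w) ()
stuck-unterminated [] (false ∷ es) (atX w) ()
stuck-unterminated [] (false ∷ es) (atC w) ()
stuck-unterminated [] (true ∷ es) end ()
stuck-unterminated [] (true ∷ es) (atV w) ()
stuck-unterminated [] (true ∷ es) (atX w) ()
stuck-unterminated [] (true ∷ es) (atC w) ()
stuck-unterminated (false ∷ ds) [] st ()
stuck-unterminated (true ∷ ds) [] st ()
stuck-unterminated (d ∷ ds) (e ∷ es) st q = stuck-unterminated ds es st (∷-injectiveʳ q)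

Key : Set
Key = ℕ × ℕ

-- This is what `rP` holds once the digits of the variable, and then one mark for each level of
-- depth, have been pushed on it. It contains no `sE`, which is thus free to end keys in `rS`.
keyWord : Key → List Σin
keyWord (d , v) = replicate d sX ʳ++ (encℕ v ʳ++ [])

keyWord-reverse : ∀ k → keyWord k ≡ reverse (encℕ (proj₂ k) ++ replicate (proj₁ k) sX)
keyWord-reverse (d , v) = sym (++-ʳ++ (encℕ v))

digits-marks-injective : ∀ ds es d e →
  map digit ds ++ replicate d sX ≡ map digit es ++ replicate e sX → ds ≡ es × d ≡ e
digits-marks-injective [] [] zero zero q = refl , refl
digits-marks-injective [] [] (suc d) (suc e) q = refl , cong suc (proj₂ (digits-marks-injective [] [] d e (∷-injectiveʳ q)))
digits-marks-injective [] (false ∷ es) zero e ()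
digits-marks-injective [] (true ∷ es) zero e ()
digits-marks-injective [] (false ∷ es) (suc d) e ()
digits-marks-injective [] (true ∷ es) (suc d) e ()
digits-marks-injective (false ∷ ds) [] d zero ()
digits-marks-injective (true ∷ ds) [] d zero ()
digits-marks-injective (false ∷ ds) [] d (suc e) ()
digits-marks-injective (true ∷ ds) [] d (suc e) ()
digits-marks-injective (false ∷ ds) (false ∷ es) d e q with digits-marks-injective ds es d e (∷-injectiveʳ q)
... | refl , r = refl , r
digits-marks-injective (true ∷ ds) (true ∷ es) d e q with digits-marks-injective ds es d e (∷-injectiveʳ q)
... | refl , r = refl , r

-- Reversed, the word is a digit string followed by marks `sX`; no mark is a digit, so the boundary
-- can be recovered.
keyWord-injective : ∀ k l → keyWord k ≡ keyWord l → k ≡ l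
keyWord-injective k@(d , v) l@(e , u) q with digits-marks-injective (bitsℕ v) (bitsℕ u) d e
  (trans (cong (_++ replicate d sX) (sym (encℕ-bits v)))
    (trans (reverse-injective (trans (sym (keyWord-reverse k)) (trans q (keyWord-reverse l))))
      (cong (_++ replicate e sX) (encℕ-bits u))))
... | p , refl = cong (d ,_) (trans (sym (numeral-bitsℕ v)) (trans (cong numeral p) (numeral-bitsℕ u)))

keyWord-letters : ∀ k → Letters (keyWord k)
keyWord-letters (d , v) = All-ʳ++ (marks d) (All-ʳ++ (subst Letters (sym (encℕ-bits v)) (letters (bitsℕ v))) [])
  where
  marks : ∀ d → Letters (replicate d sX)
  marks zero = []
  marks (suc d) = refl ∷ marks d
  letters : ∀ ds → Letters (map digit ds)
  letters [] = []
  letters (false ∷ ds) = refl ∷ letters ds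
  letters (true ∷ ds) = refl ∷ letters ds

keyWord-numeral : ∀ d ds → keyWord (d , numeral ds) ≡ replicate d sX ʳ++ (map digit ds ʳ++ [])
keyWord-numeral d ds = cong (λ xs → replicate d sX ʳ++ (xs ʳ++ [])) (encℕ-numeral ds)

length-keyWord-numeral : ∀ d ds → length (keyWord (d , numeral ds)) ≡ d + length ds
length-keyWord-numeral d ds rewrite keyWord-numeral d ds = begin
  length (replicate d sX ʳ++ (map digit ds ʳ++ []))        ≡⟨ length-ʳ++ (replicate d sX) ⟩
  length (replicate d sX) + length (map digit ds ʳ++ [])   ≡⟨ cong₂ _+_ (length-replicate d) (length-ʳ++ (map digit ds)) ⟩
  d + (length (map digit ds) + 0)                          ≡⟨ cong (d +_) (+-identityʳ _) ⟩
  d + length (map digit ds)                                ≡⟨ cong (d +_) (length-map digit ds) ⟩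
  d + length ds                                            ∎
  where open ≡-Reasoning

-- Addition of one pair over GF(2), that is, symmetric difference with a singleton on lists without
-- repetitions. Equality is tested on words and a new key goes to the far end, as in the scan that
-- the program performs.
toggle : Key → List Key → List Key
toggle k [] = k ∷ []
toggle k (k′ ∷ ks) = if eqWord (keyWord k′) (keyWord k) then ks else k′ ∷ toggle k ks

-- Every key is terminated by `sE`, not merely separated from the next: the pair (0 , 0) has the
-- empty word, and a set containing it alone must still be distinguishable from the empty set.
serialise : List Key → List Σin
serialise [] = []
serialise (k ∷ ks) = keyWord k ++ sE ∷ serialise ks

-- The decision program

data Token : Set where
  variable-token next-token connective-token : Token

-- The formula is parsed top-down.  rK is the stack of pending argument positions: digit b stands for a
-- subformula still to be read, relevant to the value iff b, and sX for leaving the scope of an X.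
-- rD holds the current X-depth in unary, rC the constant term (nonempty iff 1), and rS the set of
-- pairs (depth, variable) read an odd number of times so far; rT, rP, rR are scratch.
pattern rI = fzero
pattern rK = fsuc fzero
pattern rD = fsuc (fsuc fzero)
pattern rS = fsuc (fsuc (fsuc fzero))
pattern rT = fsuc (fsuc (fsuc (fsuc fzero)))
pattern rP = fsuc (fsuc (fsuc (fsuc (fsuc fzero))))
pattern rR = fsuc (fsuc (fsuc (fsuc (fsuc (fsuc fzero)))))
pattern rC = fsuc (fsuc (fsuc (fsuc (fsuc (fsuc (fsuc fzero))))))

-- All numbers from `L` on are identified with `L`. This keeps the value of a numeral in finite
-- control and still tells whether it is a valid index, that is, less than `L`.
cap : (L : ℕ) → ℕ → Fin (suc L)
cap L n = fromℕ< {n ⊓ L} (s≤s (m⊓n≤n n L))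

module Decision (B : List BFun) (linear : All IsLinear B) where

  L : ℕ
  L = length B

  coefficients : ∀ j → Vec Bool (arity (List.lookup B j))
  coefficients j = proj₁ (linearAt linear j)

  constant : ∀ j → Bool
  constant j = proj₁ (proj₂ (linearAt linear j))

  data Label : Set where
    start main restore insert discard moveBack depthOut depthIn finish : Label
    context : Token → Label
    digits connective : Bool → Label
    value : Bool → Fin (suc L) → Label
    compare : Bool → Label

  finite-Label : Finite Label
  finite-Label = finite-retract (finite-× (finite-Fin {16}) (finite-× finite-Bool (finite-Fin {suc L})))
    (λ { start → σ0 , false , fzero ; main → σ1 , false , fzero ; restore → σV , false , fzero
       ; insert → σX , false , fzero ; discard → σC , false , fzero ; moveBack → σE , false , fzero
       ; depthOut → fsuc σE , false , fzero ; depthIn → fsuc (fsuc σE) , false , fzero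
       ; finish → fsuc (fsuc (fsuc σE)) , false , fzero
       ; (context variable-token) → fsuc (fsuc (fsuc (fsuc σE))) , false , fzero
       ; (context next-token) → fsuc (fsuc (fsuc (fsuc (fsuc σE)))) , false , fzero
       ; (context connective-token) → fsuc (fsuc (fsuc (fsuc (fsuc (fsuc σE))))) , false , fzero
       ; (digits b) → fsuc (fsuc (fsuc (fsuc (fsuc (fsuc (fsuc σE)))))) , b , fzero
       ; (connective b) → fsuc (fsuc (fsuc (fsuc (fsuc (fsuc (fsuc (fsuc σE))))))) , b , fzero
       ; (value b v) → fsuc (fsuc (fsuc (fsuc (fsuc (fsuc (fsuc (fsuc (fsuc σE)))))))) , b , v
       ; (compare e) → fsuc (fsuc (fsuc (fsuc (fsuc (fsuc (fsuc (fsuc (fsuc (fsuc σE))))))))) , e , fzero })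
    (λ { (σ0 , b , v) → start ; (σ1 , b , v) → main ; (σV , b , v) → restore
       ; (σX , b , v) → insert ; (σC , b , v) → discard ; (σE , b , v) → moveBack
       ; (fsuc σE , b , v) → depthOut ; (fsuc (fsuc σE) , b , v) → depthIn
       ; (fsuc (fsuc (fsuc σE)) , b , v) → finish
       ; (fsuc (fsuc (fsuc (fsuc σE))) , b , v) → context variable-token
       ; (fsuc (fsuc (fsuc (fsuc (fsuc σE)))) , b , v) → context next-token
       ; (fsuc (fsuc (fsuc (fsuc (fsuc (fsuc σE))))) , b , v) → context connective-token
       ; (fsuc (fsuc (fsuc (fsuc (fsuc (fsuc (fsuc σE)))))) , b , v) → digits b
       ; (fsuc (fsuc (fsuc (fsuc (fsuc (fsuc (fsuc (fsuc σE))))))) , b , v) → connective b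
       ; (fsuc (fsuc (fsuc (fsuc (fsuc (fsuc (fsuc (fsuc (fsuc σE)))))))) , b , v) → value b v
       ; (fsuc (fsuc (fsuc (fsuc (fsuc (fsuc (fsuc (fsuc (fsuc (fsuc σE))))))))) , b , v) → compare b })
    (λ { start → refl ; main → refl ; restore → refl ; insert → refl ; discard → refl ; moveBack → refl
       ; depthOut → refl ; depthIn → refl ; finish → refl ; (context variable-token) → refl
       ; (context next-token) → refl ; (context connective-token) → refl ; (digits b) → refl
       ; (connective b) → refl ; (value b v) → refl ; (compare e) → refl })

  open StackProgram 8 Label

  -- The pushes for the tail run before the push for the head, so the first argument ends on top. An
  -- argument is relevant iff the connective is relevant and its own coefficient is 1.
  pushArguments : Bool → ∀ {n} → Vec Bool n → Code → Code
  pushArguments b [] c = c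
  pushArguments b (s ∷ ss) c = pushArguments b ss (push rK (digit (b ∧ s)) c)

  flipConstant : Bool → Code → Code
  flipConstant false c = c
  flipConstant true c = pop rC λ { nothing → push rC s0 c ; (just _) → c }

  applyConnective : Bool → Fin L → Code
  applyConnective b j = flipConstant (b ∧ constant j) (pushArguments b (coefficients j) (goto main))

  selectConnective : Bool → {v : ℕ} → Dec (v < L) → Code
  selectConnective b (yes v<L) = applyConnective b (fromℕ< v<L)
  selectConnective b (no _) = halt false

  afterContext : Token → Bool → Code
  afterContext variable-token b = goto (digits b)
  afterContext next-token b = push rK sX (push rK (digit b) (push rD sX (goto main)))
  afterContext connective-token b = goto (connective b)

  mainCode : Maybe Σin → Code
  mainCode nothing = goto finish
  mainCode (just σV) = goto (context variable-token)
  mainCode (just σX) = goto (context next-token)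
  mainCode (just σC) = goto (context connective-token)
  mainCode (just _) = halt false

  -- Scopes of X are closed lazily, when the token after them arrives; the label remembers that
  -- token while marks are removed from `rK` and `rD`.
  contextCode : Token → Maybe Σin → Code
  contextCode tok (just σ0) = afterContext tok false
  contextCode tok (just σ1) = afterContext tok true
  contextCode tok (just σX) = pop rD λ _ → goto (context tok)
  contextCode tok _ = halt false

  digitsCode : Bool → Maybe Σin → Code
  digitsCode false (just σ0) = goto (digits false)
  digitsCode false (just σ1) = goto (digits false)
  digitsCode false (just σE) = goto main
  digitsCode true (just σ0) = push rP s0 (goto (digits true))
  digitsCode true (just σ1) = push rP s1 (goto (digits true))
  digitsCode true (just σE) = goto depthOut
  digitsCode b _ = halt false

  connectiveCode : Bool → Maybe Σin → Code
  connectiveCode b (just σ0) = push rP s0 (goto (connective b))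
  connectiveCode b (just σ1) = push rP s1 (goto (connective b))
  connectiveCode b (just σE) = goto (value b fzero)
  connectiveCode b _ = halt false

  valueCode : Bool → Fin (suc L) → Maybe Σin → Code
  valueCode b v nothing = selectConnective b (toℕ v <? L)
  valueCode b v (just σ0) = goto (value b (cap L (suc (2 * toℕ v))))
  valueCode b v (just _) = goto (value b (cap L (2 * suc (toℕ v))))

  -- The sought key is in `rP`. During a comparison its letters move to `rR` and the scanned letters
  -- of the set to `rT`, so both can be recovered. After a match the terminator is not copied to
  -- `rT`, which leaves only the letters of the key to be discarded.
  keyEnd : Bool → Maybe Σin → Code
  keyEnd e (just a) = push rR a (push rT sE (goto restore))
  keyEnd false nothing = push rT sE (goto restore)
  keyEnd true nothing = goto discard

  compareLetter : Bool → Σin → Maybe Σin → Code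
  compareLetter e a nothing = goto (compare false)
  compareLetter e a (just b) = push rR b (goto (compare (e ∧ eqSym a b)))

  compareCode : Bool → Maybe Σin → Code
  compareCode e nothing = goto insert
  compareCode e (just a) = if isE a then pop rP (keyEnd e) else push rT a (pop rP (compareLetter e a))

  moveTo : Fin 8 → Label → Code → Maybe Σin → Code
  moveTo r l c nothing = c
  moveTo r l c (just a) = push r a (goto l)

  answerCode : Maybe Σin → Code
  answerCode (just _) = halt true
  answerCode nothing = pop rC λ { (just _) → halt true ; nothing → halt false }

  -- A scope of X may end together with the input, so leftover marks are harmless; a leftover digit
  -- is an argument that was never supplied.
  finishCode : Maybe Σin → Code
  finishCode nothing = pop rS answerCode
  finishCode (just σX) = goto finish
  finishCode (just _) = halt false

  body : Label → Code
  body start = push rK s1 (goto main)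
  body main = pop rI mainCode
  body (context tok) = pop rK (contextCode tok)
  body (digits b) = pop rI (digitsCode b)
  body (connective b) = pop rI (connectiveCode b)
  body (value b v) = pop rP (valueCode b v)
  -- Reading a stack empties it, so the depth is copied both to the key and to `rR`, from which
  -- `depthIn` restores it.
  body depthOut = pop rD λ { nothing → goto depthIn ; (just a) → push rR a (push rP a (goto depthOut)) }
  body depthIn = pop rR (moveTo rD depthIn (goto (compare true)))
  body (compare e) = pop rS (compareCode e)
  body restore = pop rR (moveTo rP restore (goto (compare true)))
  body insert = pop rP (moveTo rT insert (push rT sE (goto moveBack)))
  -- After a match `rR` has exactly as many letters as the copy of the matching key on top of `rT`,
  -- so popping both in step removes that copy.
  body discard = pop rR λ { nothing → goto moveBack ; (just _) → pop rT λ _ → goto discard }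
  body moveBack = pop rT (moveTo rS moveBack (goto main))
  body finish = pop rK finishCode

  -- Step counts of the loops

  Runs : ℕ → Code → Store → Bool → Set
  Runs = Halts body

  Runs-mono : ∀ {t t′ c s b} → t ≤ t′ → Runs t c s b → Runs t′ c s b
  Runs-mono = Halts-mono body

  store : (i k d s t p r c : List Σin) → Store
  store i k d s t p r c = i ∷ k ∷ d ∷ s ∷ t ∷ p ∷ r ∷ c ∷ []

  Runs-loop : ∀ {n n′ u c s b} e → n ≤ n′ → Runs (n * e + u) c s b → Runs (n′ * e + u) c s b
  Runs-loop {u = u} e le = Runs-mono (+-monoˡ-≤ u (*-monoˡ-≤ e le))

  module _ {i k c : List Σin} {t : ℕ} {b : Bool} where

    -- This lemma and the similar ones below prepend a loop to a given run from its exit, so the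
    -- answer and the remaining time need not be known in advance.
    depthIn-run : ∀ rs {d′ s ts ps} → Runs t (goto (compare true)) (store i k (rs ʳ++ d′) s ts ps [] c) b →
      Runs (length rs * 3 + (2 + t)) (goto depthIn) (store i k d′ s ts ps rs c) b
    depthIn-run [] x = goto (pop x)
    depthIn-run (a ∷ rs) x = goto (pop (push (depthIn-run rs x)))

    depthOut-run : ∀ ds {s ts ps rs} → Runs t (goto depthIn) (store i k [] s ts (ds ʳ++ ps) (ds ʳ++ rs) c) b →
      Runs (length ds * 4 + (2 + t)) (goto depthOut) (store i k ds s ts ps rs c) b
    depthOut-run [] x = goto (pop x)
    depthOut-run (a ∷ ds) x = goto (pop (push (push (depthOut-run ds x))))

  module _ {i k d c : List Σin} {t : ℕ} {b : Bool} where

    moveBack-run : ∀ ts {s} → Runs t (goto main) (store i k d (ts ʳ++ s) [] [] [] c) b →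
      Runs (length ts * 3 + (2 + t)) (goto moveBack) (store i k d s ts [] [] c) b
    moveBack-run [] x = goto (pop x)
    moveBack-run (a ∷ ts) x = goto (pop (push (moveBack-run ts x)))

    restore-run : ∀ rs {s ts ps} → Runs t (goto (compare true)) (store i k d s ts (rs ʳ++ ps) [] c) b →
      Runs (length rs * 3 + (2 + t)) (goto restore) (store i k d s ts ps rs c) b
    restore-run [] x = goto (pop x)
    restore-run (a ∷ rs) x = goto (pop (push (restore-run rs x)))

    insert-run : ∀ ps {s ts} → Runs t (goto moveBack) (store i k d s (sE ∷ (ps ʳ++ ts)) [] [] c) b →
      Runs (length ps * 3 + (3 + t)) (goto insert) (store i k d s ts ps [] c) b
    insert-run [] x = goto (pop (push x))
    insert-run (a ∷ ps) x = goto (pop (push (insert-run ps x)))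

    discard-run : ∀ rs {s ts} → Runs t (goto moveBack) (store i k d s ts [] [] c) b →
      Runs (length rs * 3 + (2 + t)) (goto discard) (store i k d s (rs ++ ts) [] rs c) b
    discard-run [] x = goto (pop x)
    discard-run (a ∷ rs) x = goto (pop (pop (discard-run rs x)))

    compare-same : ∀ xs {s ts rs} → Letters xs → Runs t (goto discard) (store i k d s (xs ʳ++ ts) [] (xs ʳ++ rs) c) b →
      Runs (length xs * 5 + (3 + t)) (goto (compare true)) (store i k d (xs ++ sE ∷ s) ts xs rs c) b
    compare-same [] ls x = goto (pop (pop x))
    compare-same (a ∷ xs) {s} {ts} {rs} (l ∷ ls) x = goto (pop letter)
      where
      letter : Runs (3 + (length xs * 5 + (3 + t))) (compareCode true (just a)) (store i k d (xs ++ sE ∷ s) ts (a ∷ xs) rs c) b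
      letter rewrite l = push (pop (push next))
        where
        next : Runs (length xs * 5 + (3 + t)) (goto (compare (eqSym a a))) (store i k d (xs ++ sE ∷ s) (a ∷ ts) xs (a ∷ rs) c) b
        next rewrite eqSym-refl a = compare-same xs ls x

    -- The flag `e` records agreement so far. The invariants are that `e` together with equality of
    -- the unread parts is false, and that `rs ʳ++ ys` is the whole sought key, which the final
    -- restoring loop puts back.
    compare-differs : ∀ n xs ys e {s ts rs} → Letters xs → e ∧ eqWord xs ys ≡ false → length rs + length ys ≤ n →
      Runs t (goto (compare true)) (store i k d s (sE ∷ (xs ʳ++ ts)) (rs ʳ++ ys) [] c) b →
      Runs (length xs * 5 + (5 + (n * 3 + (2 + t)))) (goto (compare e)) (store i k d (xs ++ sE ∷ s) ts ys rs c) b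
    compare-differs n [] [] false {rs = rs} ls ne le x = Runs-mono (n≤1+n _)
      (goto (pop (pop (push (Runs-loop 3 (m+n≤o⇒m≤o (length rs) le) (restore-run rs x))))))
    compare-differs n [] (y ∷ ys) e {rs = rs} ls ne le x =
      goto (pop (pop (push (push (Runs-loop 3 (≤-trans (s≤s (m≤m+n _ (length ys))) (≤-trans (≤-reflexive (sym (+-suc _ _))) le))
        (restore-run (y ∷ rs) x))))))
    compare-differs n (a ∷ xs) [] e {s} {ts} {rs} (l ∷ ls) ne le x = goto (pop letter)
      where
      letter : Runs (3 + (length xs * 5 + (5 + (n * 3 + (2 + t))))) (compareCode e (just a)) (store i k d (xs ++ sE ∷ s) ts [] rs c) b
      letter rewrite l = push (pop (Runs-mono (n≤1+n _) (compare-differs n xs [] false ls refl le x)))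
    compare-differs n (a ∷ xs) (y ∷ ys) e {s} {ts} {rs} (l ∷ ls) ne le x = goto (pop letter)
      where
      letter : Runs (3 + (length xs * 5 + (5 + (n * 3 + (2 + t))))) (compareCode e (just a)) (store i k d (xs ++ sE ∷ s) ts (y ∷ ys) rs c) b
      letter rewrite l = push (pop (push (compare-differs n xs ys (e ∧ eqSym a y) ls
        (trans (∧-assoc e (eqSym a y) (eqWord xs ys)) ne) (≤-trans (≤-reflexive (sym (+-suc _ _))) le) x)))

  module _ {i k d c : List Σin} {t : ℕ} {b : Bool} where

    -- `ts` accumulates the scanned keys in reverse. A scanned key costs 5 steps a letter and at
    -- most `n * 3 + 7` at its terminator, so `n * 3 + 7` for every letter of the serialised set
    -- pays for the scan. `n` bounds the sought key and `Z` the height of `rT` when it is moved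
    -- back.
    toggle-run : ∀ ks key n Z {ts} → length (keyWord key) ≤ n → length ts + length (serialise ks) + suc n ≤ Z →
      Runs t (goto main) (store i k d (ts ʳ++ serialise (toggle key ks)) [] [] [] c) b →
      Runs (length (serialise ks) * (n * 3 + 7) + (n * 3 + (5 + (Z * 3 + (2 + t))))) (goto (compare true))
        (store i k d (serialise ks) ts (keyWord key) [] c) b
    toggle-run [] key n Z {ts} le le′ x =
      Runs-mono (≤-reflexive (arith (n * 3) (Z * 3 + (2 + t)))) (goto (pop (Runs-loop 3 le (insert-run (keyWord key)
        (Runs-loop 3 height (moveBack-run (sE ∷ (keyWord key ʳ++ ts))
          (subst (λ s → Runs t (goto main) (store i k d s [] [] [] c) b) (sym (ʳ++-ʳ++ (keyWord key))) x)))))))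
      where
      arith : ∀ m u → 2 + (m + (3 + u)) ≡ m + (5 + u)
      arith = solve-∀
      height : suc (length (keyWord key ʳ++ ts)) ≤ Z
      height = begin
        suc (length (keyWord key ʳ++ ts))           ≡⟨ cong suc (length-ʳ++ (keyWord key)) ⟩
        suc (length (keyWord key) + length ts)      ≤⟨ s≤s (+-monoˡ-≤ (length ts) le) ⟩
        suc n + length ts                           ≡⟨ +-comm (suc n) (length ts) ⟩
        length ts + suc n                           ≡⟨ cong (_+ suc n) (sym (+-identityʳ (length ts))) ⟩
        length ts + 0 + suc n                       ≤⟨ le′ ⟩
        Z                                           ∎
        where open ≤-Reasoning
    toggle-run (k′ ∷ ks) key n Z {ts} le le′ x with eqWord (keyWord k′) (keyWord key) in same
    ... | true = subst (λ w → Runs _ (goto (compare true)) (store i k d (serialise (k′ ∷ ks)) ts w [] c) b) e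
        (Runs-mono bound (compare-same (keyWord k′) (keyWord-letters k′)
          (subst (λ ts′ → Runs _ (goto discard) (store i k d _ ts′ [] (keyWord k′ ʳ++ []) c) b)
            (sym (ʳ++-defn (keyWord k′)))
            (discard-run (keyWord k′ ʳ++ []) (Runs-loop 3 height (moveBack-run ts x))))))
      where
      e : keyWord k′ ≡ keyWord key
      e = eqWord⇒≡ _ _ same
      height : length ts ≤ Z
      height = ≤-trans (m≤m+n (length ts) (length (serialise (k′ ∷ ks)))) (m+n≤o⇒m≤o _ le′)
      arith : ∀ m n r u → (m + suc r) * (n * 3 + 7) + (n * 3 + (5 + u)) ≡
        (m * 5 + (3 + (n * 3 + (2 + u)))) + (m * (n * 3 + 2) + (n * 3 + 7) + r * (n * 3 + 7))
      arith = solve-∀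
      length-k′ : length (keyWord k′ ʳ++ []) ≤ n
      length-k′ = ≤-trans (≤-reflexive (trans (length-ʳ++ (keyWord k′)) (trans (+-identityʳ _) (cong length e)))) le
      bound : length (keyWord k′) * 5 + (3 + (length (keyWord k′ ʳ++ []) * 3 + (2 + (Z * 3 + (2 + t))))) ≤
        length (serialise (k′ ∷ ks)) * (n * 3 + 7) + (n * 3 + (5 + (Z * 3 + (2 + t))))
      bound = begin
        length (keyWord k′) * 5 + (3 + (length (keyWord k′ ʳ++ []) * 3 + (2 + u)))
          ≤⟨ +-monoʳ-≤ (length (keyWord k′) * 5) (+-monoʳ-≤ 3 (+-monoˡ-≤ (2 + u) (*-monoˡ-≤ 3 length-k′))) ⟩
        length (keyWord k′) * 5 + (3 + (n * 3 + (2 + u)))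
          ≤⟨ m≤m+n _ _ ⟩
        _ ≡⟨ sym (arith (length (keyWord k′)) n (length (serialise ks)) u) ⟩
        (length (keyWord k′) + suc (length (serialise ks))) * (n * 3 + 7) + (n * 3 + (5 + u))
          ≡⟨ cong (λ z → z * (n * 3 + 7) + (n * 3 + (5 + u))) (sym (length-++ (keyWord k′))) ⟩
        length (serialise (k′ ∷ ks)) * (n * 3 + 7) + (n * 3 + (5 + u)) ∎
        where
        open ≤-Reasoning
        u = Z * 3 + (2 + t)
    ... | false = Runs-mono bound (compare-differs n (keyWord k′) (keyWord key) true (keyWord-letters k′) same le
        (toggle-run ks key n Z le height
          (subst (λ s → Runs t (goto main) (store i k d s [] [] [] c) b) (sym (ʳ++-ʳ++ (keyWord k′))) x)))
      where
      height : suc (length (keyWord k′ ʳ++ ts)) + length (serialise ks) + suc n ≤ Z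
      height = begin
        suc (length (keyWord k′ ʳ++ ts)) + length (serialise ks) + suc n
          ≡⟨ cong (λ z → suc z + length (serialise ks) + suc n) (length-ʳ++ (keyWord k′)) ⟩
        suc (length (keyWord k′) + length ts) + length (serialise ks) + suc n
          ≡⟨ arith (length (keyWord k′)) (length ts) (length (serialise ks)) n ⟩
        length ts + (length (keyWord k′) + suc (length (serialise ks))) + suc n
          ≡⟨ cong (λ z → length ts + z + suc n) (sym (length-++ (keyWord k′))) ⟩
        length ts + length (serialise (k′ ∷ ks)) + suc n
          ≤⟨ le′ ⟩
        Z ∎
        where
        open ≤-Reasoning
        arith : ∀ a b c n → suc (a + b) + c + suc n ≡ b + (a + suc c) + suc n
        arith = solve-∀
      arith : ∀ m n r v → (m + suc r) * (n * 3 + 7) + v ≡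
        (m * 5 + (5 + (n * 3 + (2 + (r * (n * 3 + 7) + v))))) + m * (n * 3 + 2)
      arith = solve-∀
      bound : length (keyWord k′) * 5 + (5 + (n * 3 + (2 + (length (serialise ks) * (n * 3 + 7) + (n * 3 + (5 + (Z * 3 + (2 + t)))))))) ≤
        length (serialise (k′ ∷ ks)) * (n * 3 + 7) + (n * 3 + (5 + (Z * 3 + (2 + t))))
      bound = begin
        length (keyWord k′) * 5 + (5 + (n * 3 + (2 + (length (serialise ks) * (n * 3 + 7) + v))))
          ≤⟨ m≤m+n _ _ ⟩
        _ ≡⟨ sym (arith (length (keyWord k′)) n (length (serialise ks)) v) ⟩
        (length (keyWord k′) + suc (length (serialise ks))) * (n * 3 + 7) + v
          ≡⟨ cong (λ z → z * (n * 3 + 7) + v) (sym (length-++ (keyWord k′))) ⟩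
        length (serialise (k′ ∷ ks)) * (n * 3 + 7) + v ∎
        where
        open ≤-Reasoning
        v = n * 3 + (5 + (Z * 3 + (2 + t)))

-- Sums over GF(2) and the choice of a structure

swap-xor : ∀ x y z → x xor (y xor z) ≡ y xor (x xor z)
swap-xor x y z = trans (sym (xor-assoc x y z)) (trans (cong (_xor z) (xor-comm x y)) (xor-assoc y x z))

keySum : Structure → List Key → Bool
keySum ξ = foldr (λ k acc → ξ (proj₁ k) (proj₂ k) xor acc) false

keySum-toggle : ∀ ξ k ks → keySum ξ (toggle k ks) ≡ ξ (proj₁ k) (proj₂ k) xor keySum ξ ks
keySum-toggle ξ k [] = refl
keySum-toggle ξ k (k′ ∷ ks) with eqWord (keyWord k′) (keyWord k) in same
... | true rewrite keyWord-injective k′ k (eqWord⇒≡ _ _ same) =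
  sym (trans (sym (xor-assoc x x (keySum ξ ks))) (cong (_xor keySum ξ ks) (xor-same x)))
  where x = ξ (proj₁ k) (proj₂ k)
... | false rewrite keySum-toggle ξ k ks = swap-xor (ξ (proj₁ k′) (proj₂ k′)) (ξ (proj₁ k) (proj₂ k)) (keySum ξ ks)

eqWord-refl : ∀ as → eqWord as as ≡ true
eqWord-refl [] = refl
eqWord-refl (a ∷ as) rewrite eqSym-refl a = eqWord-refl as

toggle-fresh : ∀ k {k′} ks → k′ ≢ k → All (k′ ≢_) ks → All (k′ ≢_) (toggle k ks)
toggle-fresh k [] ne [] = ne ∷ []
toggle-fresh k (l ∷ ks) ne (p ∷ ps) with eqWord (keyWord l) (keyWord k)
... | true = ps
... | false = p ∷ toggle-fresh k ks ne ps

toggle-unique : ∀ k ks → Unique ks → Unique (toggle k ks)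
toggle-unique k [] [] = [] ∷ []
toggle-unique k (l ∷ ks) (p ∷ ps) with eqWord (keyWord l) (keyWord k) in same
... | true = ps
... | false = toggle-fresh k ks distinct p ∷ toggle-unique k ks ps
  where
  distinct : l ≢ k
  distinct refl with trans (sym same) (eqWord-refl (keyWord l))
  ... | ()

length-serialise-toggle : ∀ k ks → length (serialise (toggle k ks)) ≤ length (serialise ks) + suc (length (keyWord k))
length-serialise-toggle k [] = ≤-reflexive (trans (length-++ (keyWord k)) (+-comm (length (keyWord k)) 1))
length-serialise-toggle k (l ∷ ks) with eqWord (keyWord l) (keyWord k)
... | true = ≤-trans (≤-trans (m≤n+m (length (serialise ks)) (suc (length (keyWord l))))
  (≤-reflexive (trans (sym (+-suc (length (keyWord l)) _)) (sym (length-++ (keyWord l)))))) (m≤m+n _ _)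
... | false = begin
  length (keyWord l ++ sE ∷ serialise (toggle k ks))             ≡⟨ length-++ (keyWord l) ⟩
  a + suc (length (serialise (toggle k ks)))                     ≤⟨ +-monoʳ-≤ a (s≤s (length-serialise-toggle k ks)) ⟩
  a + suc (length (serialise ks) + suc (length (keyWord k)))     ≡⟨ sym (+-assoc a (suc (length (serialise ks))) _) ⟩
  a + suc (length (serialise ks)) + suc (length (keyWord k))     ≡⟨ cong (_+ suc (length (keyWord k))) (sym (length-++ (keyWord l))) ⟩
  length (serialise (l ∷ ks)) + suc (length (keyWord k))         ∎
  where
  open ≤-Reasoning
  a = length (keyWord l)

indicator : Key → Bool → Structure
indicator (d , v) b i u = if (i ≡ᵇ d) ∧ (u ≡ᵇ v) then b else false

≡ᵇ-refl : ∀ n → (n ≡ᵇ n) ≡ true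
≡ᵇ-refl zero = refl
≡ᵇ-refl (suc n) = ≡ᵇ-refl n

indicator-self : ∀ k b → indicator k b (proj₁ k) (proj₂ k) ≡ b
indicator-self (d , v) b rewrite ≡ᵇ-refl d | ≡ᵇ-refl v = refl

indicator-other : ∀ k b k′ → k ≢ k′ → indicator k b (proj₁ k′) (proj₂ k′) ≡ false
indicator-other (d , v) b (d′ , v′) ne with d′ ≡ᵇ d in p | v′ ≡ᵇ v in q
... | true | true = ⊥-elim (ne (cong₂ _,_ (sym (≡ᵇ⇒≡ d′ d (T-true p))) (sym (≡ᵇ⇒≡ v′ v (T-true q)))))
  where
  T-true : ∀ {x} → x ≡ true → IsTrue x
  T-true refl = _
... | true | false = refl
... | false | _ = refl

keySum-indicator : ∀ k b ks → All (k ≢_) ks → keySum (indicator k b) ks ≡ false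
keySum-indicator k b [] [] = refl
keySum-indicator k b (k′ ∷ ks) (p ∷ ps) rewrite indicator-other k b k′ p = keySum-indicator k b ks ps

accumulated : Bool → List Key → Structure → Bool
accumulated c ks ξ = c xor keySum ξ ks

-- Distinct keys can be assigned independently, so a nonempty sum takes both values.
accumulated-satisfiable : ∀ c k ks → Unique (k ∷ ks) → ∃ λ ξ → accumulated c (k ∷ ks) ξ ≡ true
accumulated-satisfiable c k ks (p ∷ _) = indicator k (not c) , holds c
  where
  holds : ∀ c → accumulated c (k ∷ ks) (indicator k (not c)) ≡ true
  holds c rewrite indicator-self k (not c) | keySum-indicator k (not c) ks p = cancel c
    where
    cancel : ∀ c → c xor (not c xor false) ≡ true
    cancel false = refl
    cancel true = refl

-- Pending positions and completions of the unread word

data Context : Set where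
  argument : Bool → Context
  leave    : Context

contextSymbol : Context → Σin
contextSymbol (argument b) = digit b
contextSymbol leave = sX

arguments : Bool → ∀ {n} → Vec Bool n → List Context
arguments b [] = []
arguments b (s ∷ ss) = argument (b ∧ s) ∷ arguments b ss

affine : ∀ {n} → Vec Bool n → Bool → Vec Bool n → Bool
affine ss c xs = Vec.foldr (λ _ → Bool) _xor_ c (zipWith _∧_ ss xs)

-- w splits into formulas filling the pending positions Ks, and the sum f of what was read before plus
-- the values of the relevant formulas is 1 in some structure.
Completes : (B : List BFun) → List Context → ℕ → List Σin → (Structure → Bool) → Set
Completes B [] d w f = w ≡ [] × ∃ λ ξ → f ξ ≡ true
Completes B (leave ∷ Ks) d w f = Completes B Ks (pred d) w f
Completes B (argument b ∷ Ks) d w f = Σ (Form B) λ φ → Σ (List Σin) λ w′ →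
  w ≡ enc φ ++ w′ × Completes B Ks d w′ (λ ξ → (b ∧ eval ξ d φ) xor f ξ)

Completes-cong : ∀ {B} Ks {d w f g} → f ≗ g → Completes B Ks d w f → Completes B Ks d w g
Completes-cong [] e (p , ξ , q) = p , ξ , trans (sym (e ξ)) q
Completes-cong (leave ∷ Ks) e x = Completes-cong Ks e x
Completes-cong (argument b ∷ Ks) {d} e (φ , w′ , p , x) =
  φ , w′ , p , Completes-cong Ks (λ ξ → cong ((b ∧ eval ξ d φ) xor_) (e ξ)) x

data NotToken : Σin → Set where
  not-s0 : NotToken s0
  not-s1 : NotToken s1
  not-sE : NotToken sE

not-token : ∀ {B a} Ks {d w f} → NotToken a → ¬ Completes B Ks d (a ∷ w) f
not-token [] nt (() , _)
not-token (leave ∷ Ks) nt x = not-token Ks nt x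
not-token (argument b ∷ Ks) not-s0 (var v , w′ , () , _)
not-token (argument b ∷ Ks) not-s0 (X φ , w′ , () , _)
not-token (argument b ∷ Ks) not-s0 (app j φs , w′ , () , _)
not-token (argument b ∷ Ks) not-s1 (var v , w′ , () , _)
not-token (argument b ∷ Ks) not-s1 (X φ , w′ , () , _)
not-token (argument b ∷ Ks) not-s1 (app j φs , w′ , () , _)
not-token (argument b ∷ Ks) not-sE (var v , w′ , () , _)
not-token (argument b ∷ Ks) not-sE (X φ , w′ , () , _)
not-token (argument b ∷ Ks) not-sE (app j φs , w′ , () , _)

nothing-completes-argument : ∀ {B b} Ks {d f} → ¬ Completes B (argument b ∷ Ks) d [] f
nothing-completes-argument Ks (var v , w′ , () , _)
nothing-completes-argument Ks (X φ , w′ , () , _)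
nothing-completes-argument Ks (app j φs , w′ , () , _)

-- Evaluating `X φ` at depth `d` unfolds to evaluating `φ` at `suc d`, and `leave` undoes the
-- increment, so the witness for the rest of the word is kept unchanged.
Completes-X : ∀ {B b} Ks {d w f} →
  Completes B (argument b ∷ leave ∷ Ks) (suc d) w f ⇔ Completes B (argument b ∷ Ks) d (sX ∷ w) f
Completes-X {B} {b} Ks {d} {w} {f} = mk⇔ to from
  where
  to : Completes B (argument b ∷ leave ∷ Ks) (suc d) w f → Completes B (argument b ∷ Ks) d (sX ∷ w) f
  to (φ , w′ , p , x) = X φ , w′ , cong (sX ∷_) p , x
  from : Completes B (argument b ∷ Ks) d (sX ∷ w) f → Completes B (argument b ∷ leave ∷ Ks) (suc d) w f
  from (X φ , w′ , refl , x) = φ , w′ , refl , x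
  from (var v , w′ , () , x)
  from (app j φs , w′ , () , x)

var-word : ∀ v w → (encℕ v ++ sE ∷ []) ++ w ≡ encℕ v ++ sE ∷ w
var-word v w = ++-assoc (encℕ v) (sE ∷ []) w

Completes-V : ∀ {B b} Ks {d w f} ds →
  Completes B Ks d w (λ ξ → (b ∧ ξ d (numeral ds)) xor f ξ) ⇔
  Completes B (argument b ∷ Ks) d (sV ∷ map digit ds ++ sE ∷ w) f
Completes-V {B} {b} Ks {d} {w} {f} ds = mk⇔ to from
  where
  to : Completes B Ks d w (λ ξ → (b ∧ ξ d (numeral ds)) xor f ξ) →
    Completes B (argument b ∷ Ks) d (sV ∷ map digit ds ++ sE ∷ w) f
  to x = var (numeral ds) , w ,
    cong (sV ∷_) (sym (trans (var-word (numeral ds) w) (cong (_++ sE ∷ w) (encℕ-numeral ds)))) , x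
  from : Completes B (argument b ∷ Ks) d (sV ∷ map digit ds ++ sE ∷ w) f →
    Completes B Ks d w (λ ξ → (b ∧ ξ d (numeral ds)) xor f ξ)
  from (var v , w′ , p , x) with encℕ-unique v ds (trans (sym (var-word v w′)) (sym (∷-injectiveʳ p)))
  ... | refl , refl = x
  from (X φ , w′ , () , x)
  from (app j φs , w′ , () , x)

stuck-V : ∀ {B b} Ks {d w f} ds → Stuck w → ¬ Completes B (argument b ∷ Ks) d (sV ∷ map digit ds ++ w) f
stuck-V Ks ds st (var v , w′ , p , x) = stuck-unterminated ds (bitsℕ v) st
  (trans (∷-injectiveʳ p) (trans (var-word v w′) (cong (_++ sE ∷ w′) (encℕ-bits v))))
stuck-V Ks ds st (X φ , w′ , () , x)
stuck-V Ks ds st (app j φs , w′ , () , x)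

app-word : ∀ {B n} j (φs : Vec (Form B) n) w → (encℕ j ++ sE ∷ encVec φs) ++ w ≡ encℕ j ++ sE ∷ (encVec φs ++ w)
app-word j φs w = ++-assoc (encℕ j) (sE ∷ encVec φs) w

stuck-C : ∀ {B b} Ks {d w f} ds → Stuck w → ¬ Completes B (argument b ∷ Ks) d (sC ∷ map digit ds ++ w) f
stuck-C Ks ds st (app j φs , w′ , p , x) = stuck-unterminated ds (bitsℕ (toℕ j)) st
  (trans (∷-injectiveʳ p) (trans (app-word (toℕ j) φs w′) (cong (_++ sE ∷ (encVec φs ++ w′)) (encℕ-bits (toℕ j)))))
stuck-C Ks ds st (var v , w′ , () , x)
stuck-C Ks ds st (X φ , w′ , () , x)

no-connective : ∀ {B b} Ks {d w f} ds → ¬ (numeral ds < length B) →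
  ¬ Completes B (argument b ∷ Ks) d (sC ∷ map digit ds ++ sE ∷ w) f
no-connective {B} Ks ds ≮ (app j φs , w′ , p , x)
  with encℕ-unique (toℕ j) ds (trans (sym (app-word (toℕ j) φs w′)) (sym (∷-injectiveʳ p)))
... | q , _ = ≮ (subst (_< length B) q (toℕ<n j))
no-connective Ks ds ≮ (var v , w′ , () , x)
no-connective Ks ds ≮ (X φ , w′ , () , x)

CompletesApp : (B : List BFun) {n : ℕ} → Bool → Vec Bool n → Bool → List Context → ℕ → List Σin → (Structure → Bool) → Set
CompletesApp B {n} b ss c Ks d w f = Σ (Vec (Form B) n) λ φs → Σ (List Σin) λ w′ →
  w ≡ encVec φs ++ w′ × Completes B Ks d w′ (λ ξ → (b ∧ affine ss c (evalVec ξ d φs)) xor f ξ)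

-- Distributivity of the relevance `b` over the sum at a connective, with one argument `e` of
-- coefficient `s` split off.
regroup : ∀ b s e a f → (b ∧ a) xor (((b ∧ s) ∧ e) xor f) ≡ (b ∧ ((s ∧ e) xor a)) xor f
regroup false s e a f = refl
regroup true s e a f = trans (sym (xor-assoc a (s ∧ e) f)) (cong (_xor f) (xor-comm a (s ∧ e)))

-- An affine connective can be expanded before its arguments are read: its constant joins the sum at
-- once, and each argument is pending with the product of the relevances.
Completes-arguments : ∀ {B n} b (ss : Vec Bool n) c Ks {d w f} →
  Completes B (arguments b ss ++ Ks) d w (λ ξ → (b ∧ c) xor f ξ) ⇔ CompletesApp B b ss c Ks d w f
Completes-arguments {B} b ss c Ks = mk⇔ (to ss) (from ss)
  where
  to : ∀ {n} (ss : Vec Bool n) {d w f} →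
    Completes B (arguments b ss ++ Ks) d w (λ ξ → (b ∧ c) xor f ξ) → CompletesApp B b ss c Ks d w f
  to [] x = [] , _ , refl , x
  to (s ∷ ss) {d} {f = f} (φ , w₁ , refl , x)
    with to ss {f = λ ξ → ((b ∧ s) ∧ eval ξ d φ) xor f ξ}
      -- The value of the first argument is absorbed into the sum, and the constant is brought back
      -- to the front as the induction hypothesis requires.
      (Completes-cong (arguments b ss ++ Ks) (λ ξ → swap-xor ((b ∧ s) ∧ eval ξ d φ) (b ∧ c) (f ξ)) x)
  ... | φs , w′ , refl , y = φ ∷ φs , w′ , sym (++-assoc (enc φ) (encVec φs) w′) ,
    Completes-cong Ks (λ ξ → regroup b s (eval ξ d φ) (affine ss c (evalVec ξ d φs)) (f ξ)) y
  from : ∀ {n} (ss : Vec Bool n) {d w f} →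
    CompletesApp B b ss c Ks d w f → Completes B (arguments b ss ++ Ks) d w (λ ξ → (b ∧ c) xor f ξ)
  from [] ([] , w′ , refl , x) = x
  from (s ∷ ss) {d} {f = f} (φ ∷ φs , w′ , refl , x) = φ , encVec φs ++ w′ , ++-assoc (enc φ) (encVec φs) w′ ,
    Completes-cong (arguments b ss ++ Ks) (λ ξ → swap-xor (b ∧ c) ((b ∧ s) ∧ eval ξ d φ) (f ξ))
      (from ss (φs , w′ , refl ,
        Completes-cong Ks (λ ξ → sym (regroup b s (eval ξ d φ) (affine ss c (evalVec ξ d φs)) (f ξ))) x))

-- Bounds on arities and saturated numerals

arity-bound : List BFun → ℕ
arity-bound [] = 0
arity-bound (f ∷ B) = arity f + arity-bound B

arity≤bound : ∀ B j → arity (List.lookup B j) ≤ arity-bound B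
arity≤bound (f ∷ B) fzero = m≤m+n (arity f) (arity-bound B)
arity≤bound (f ∷ B) (fsuc j) = ≤-trans (arity≤bound B j) (m≤n+m (arity-bound B) (arity f))

appendDigit : ℕ → Bool → ℕ
appendDigit n b = if b then 2 * suc n else suc (2 * n)

-- The stack `rP` reverses the digits, so the most significant one is read first and Horner's scheme
-- applies.
numeral-foldl : ∀ ds → foldl appendDigit 0 (ds ʳ++ []) ≡ numeral ds
numeral-foldl ds = foldl-ʳ++ appendDigit 0 ds

appendDigit-mono : ∀ {m n} b → m ≤ n → appendDigit m b ≤ appendDigit n b
appendDigit-mono true le = *-monoʳ-≤ 2 (s≤s le)
appendDigit-mono false le = s≤s (*-monoʳ-≤ 2 le)

≤-appendDigit : ∀ n b → n ≤ appendDigit n b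
≤-appendDigit n true = ≤-trans (n≤1+n n) (m≤n*m (suc n) 2)
≤-appendDigit n false = ≤-trans (m≤n*m n 2) (n≤1+n (2 * n))

-- Appending a digit is monotone and never decreases a number, so a value that has reached `L` stays
-- at or above it: saturating at every digit agrees with saturating once at the end.
appendDigit-⊓ : ∀ n L b → appendDigit (n ⊓ L) b ⊓ L ≡ appendDigit n b ⊓ L
appendDigit-⊓ n L b with ≤-total n L
... | inj₁ n≤L = cong (λ m → appendDigit m b ⊓ L) (m≤n⇒m⊓n≡m n≤L)
... | inj₂ L≤n = begin
  appendDigit (n ⊓ L) b ⊓ L ≡⟨ cong (λ m → appendDigit m b ⊓ L) (m≥n⇒m⊓n≡n L≤n) ⟩
  appendDigit L b ⊓ L       ≡⟨ m≥n⇒m⊓n≡n (≤-appendDigit L b) ⟩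
  L                         ≡⟨ sym (m≥n⇒m⊓n≡n (≤-trans (≤-appendDigit L b) (appendDigit-mono b L≤n))) ⟩
  appendDigit n b ⊓ L       ∎
  where open ≡-Reasoning

⊓-<ˡ : ∀ {n L} → n ⊓ L < L → n < L
⊓-<ˡ {n} {L} lt with ≤-total n L
... | inj₁ n≤L = subst (_< L) (m≤n⇒m⊓n≡m n≤L) lt
... | inj₂ L≤n = ⊥-elim (<-irrefl (m≥n⇒m⊓n≡n L≤n) lt)

length-digits : ∀ ds w → length ds + length w ≡ length (map digit ds ++ w)
length-digits ds w = sym (trans (length-++ (map digit ds)) (cong (_+ length w) (length-map digit ds)))

-- Correctness of the program

module Correctness (B : List BFun) (linear : All IsLinear B) where

  open Decision B linear
  open StackProgram 8 Label

  -- The equation in `IsLinear` enters here only; the rest is uniqueness of the index numeral and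
  -- the expansion of an affine connective.
  Completes-C : ∀ b j Ks {d w f} ds → numeral ds ≡ toℕ j →
    Completes B (arguments b (coefficients j) ++ Ks) d w (λ ξ → (b ∧ constant j) xor f ξ) ⇔
    Completes B (argument b ∷ Ks) d (sC ∷ map digit ds ++ sE ∷ w) f
  Completes-C b j Ks {d} {w} {f} ds n≡j = mk⇔ to from
    where
    open Equivalence (Completes-arguments {B} b (coefficients j) (constant j) Ks {d} {w} {f}) renaming (to to split; from to unsplit)
    evaluates : ∀ (φs : Vec (Form B) (arity (List.lookup B j))) ξ →
      (b ∧ affine (coefficients j) (constant j) (evalVec ξ d φs)) xor f ξ ≡ (b ∧ eval ξ d (app j φs)) xor f ξ
    evaluates φs ξ = cong (λ x → (b ∧ x) xor f ξ) (sym (proj₂ (proj₂ (linearAt linear j)) (evalVec ξ d φs)))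
    to : Completes B (arguments b (coefficients j) ++ Ks) d w (λ ξ → (b ∧ constant j) xor f ξ) →
      Completes B (argument b ∷ Ks) d (sC ∷ map digit ds ++ sE ∷ w) f
    to x with split x
    ... | φs , w′ , refl , y = app j φs , w′ ,
      cong (sC ∷_) (trans (cong (_++ sE ∷ (encVec φs ++ w′)) (trans (sym (encℕ-numeral ds)) (cong encℕ n≡j)))
        (sym (app-word (toℕ j) φs w′))) ,
      Completes-cong Ks (evaluates φs) y
    from : Completes B (argument b ∷ Ks) d (sC ∷ map digit ds ++ sE ∷ w) f →
      Completes B (arguments b (coefficients j) ++ Ks) d w (λ ξ → (b ∧ constant j) xor f ξ)
    from (app j′ φs , w′ , p , x)
      with encℕ-unique (toℕ j′) ds (trans (sym (app-word (toℕ j′) φs w′)) (sym (∷-injectiveʳ p)))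
    ... | q , refl with toℕ-injective (trans q n≡j)
    ... | refl = unsplit (φs , w′ , refl , Completes-cong Ks (λ ξ → sym (evaluates φs ξ)) x)
    from (var v , w′ , () , x)
    from (X φ , w′ , () , x)

  data Starts : Σin → Token → Set where
    startV : Starts sV variable-token
    startX : Starts sX next-token
    startC : Starts sC connective-token

  Outcome : ℕ → Code → Store → Set → Set
  Outcome t c s P = Σ Bool λ b → Runs t c s b × (b ≡ true ⇔ P)

  reject : ∀ {t c s P} → Runs t c s false → ¬ P → Outcome t c s P
  reject x np = false , x , mk⇔ (λ ()) (λ p → ⊥-elim (np p))

  accept : ∀ {t c s P} → Runs t c s true → P → Outcome t c s P
  accept x p = true , x , mk⇔ (λ _ → p) (λ _ → refl)

  Outcome-map : ∀ {t t′ c c′ s s′ P P′} → (∀ {b} → Runs t c s b → Runs t′ c′ s′ b) → P ⇔ P′ →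
    Outcome t c s P → Outcome t′ c′ s′ P′
  Outcome-map f e (b , x , e′) = b , f x , mk⇔ (Equivalence.to e ∘ Equivalence.to e′) (Equivalence.from e′ ∘ Equivalence.from e)

  flag : Bool → List Σin
  flag false = []
  flag true = s0 ∷ []

  marks : ℕ → List Σin
  marks d = replicate d sX

  -- Popping an empty stack matches `pred zero`, so no invariant has to relate the number of pending
  -- `leave` entries to the depth.
  drop-marks : ∀ d → drop 1 (marks d) ≡ marks (pred d)
  drop-marks zero = refl
  drop-marks (suc d) = refl

  symbols : List Context → List Σin
  symbols = map contextSymbol

  -- Removing `leave` entries changes the pending list and the depth before the token is treated, so
  -- `next` is required for all that can result. At least one entry is consumed, which makes `Ks′`
  -- strictly shorter and the new depth no larger.
  context-run : ∀ tok Ks d {a w f s c t} →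
    (∀ b Ks′ d′ → length Ks′ < length Ks → d′ ≤ d →
      Outcome t (afterContext tok b) (store w (symbols Ks′) (marks d′) s [] [] [] c) (Completes B (argument b ∷ Ks′) d′ (a ∷ w) f)) →
    Outcome (length Ks * 3 + (3 + t)) (goto (context tok)) (store w (symbols Ks) (marks d) s [] [] [] c) (Completes B Ks d (a ∷ w) f)
  context-run tok [] d next = reject (goto (pop halt)) (λ { (() , _) })
  context-run tok (argument b ∷ Ks) d {t = t} next with next b Ks d ≤-refl ≤-refl
  ... | r , x , e = r , Runs-mono (≤-trans (n≤1+n (2 + t)) (m≤n+m (3 + t) (suc (length Ks) * 3))) (goto (pop (enter b x))) , e
    where
    enter : ∀ b {t s r} → Runs t (afterContext tok b) s r → Runs t (contextCode tok (just (digit b))) s r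
    enter false x = x
    enter true x = x
  context-run tok (leave ∷ Ks) d {w = w} {s = s} {c} {t} next
    with context-run tok Ks (pred d) (λ b Ks′ d′ lt le → next b Ks′ d′ (m≤n⇒m≤1+n lt) (≤-trans le (pred[n]≤n {d})))
  ... | r , x , e = r , goto (pop (pop (subst (λ ds → Runs _ (goto (context tok)) (store w (symbols Ks) ds s [] [] [] c) r) (sym (drop-marks d)) x))) , e

  module _ {k d s c : List Σin} {t : ℕ} {b : Bool} where

    digits-false-run : ∀ ds {w} → Runs t (goto main) (store w k d s [] [] [] c) b →
      Runs (length ds * 2 + (2 + t)) (goto (digits false)) (store (map digit ds ++ sE ∷ w) k d s [] [] [] c) b
    digits-false-run [] x = goto (pop x)
    digits-false-run (false ∷ ds) x = goto (pop (digits-false-run ds x))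
    digits-false-run (true ∷ ds) x = goto (pop (digits-false-run ds x))

    digits-true-run : ∀ ds {w p} → Runs t (goto depthOut) (store w k d s [] (map digit ds ʳ++ p) [] c) b →
      Runs (length ds * 3 + (2 + t)) (goto (digits true)) (store (map digit ds ++ sE ∷ w) k d s [] p [] c) b
    digits-true-run [] x = goto (pop x)
    digits-true-run (false ∷ ds) x = goto (pop (push (digits-true-run ds x)))
    digits-true-run (true ∷ ds) x = goto (pop (push (digits-true-run ds x)))

    connective-run : ∀ e ds {w p} → Runs t (goto (value e fzero)) (store w k d s [] (map digit ds ʳ++ p) [] c) b →
      Runs (length ds * 3 + (2 + t)) (goto (connective e)) (store (map digit ds ++ sE ∷ w) k d s [] p [] c) b
    connective-run e [] x = goto (pop x)
    connective-run e (false ∷ ds) x = goto (pop (push (connective-run e ds x)))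
    connective-run e (true ∷ ds) x = goto (pop (push (connective-run e ds x)))

    value-run : ∀ e ds n (v : Fin (suc L)) {w} → toℕ v ≡ n ⊓ L →
      (∀ (v′ : Fin (suc L)) → toℕ v′ ≡ foldl appendDigit n ds ⊓ L → Runs t (selectConnective e (toℕ v′ <? L)) (store w k d s [] [] [] c) b) →
      Runs (length ds * 2 + (2 + t)) (goto (value e v)) (store w k d s [] (map digit ds) [] c) b
    value-run e [] n v eq x = goto (pop (x v eq))
    value-run e (false ∷ ds) n v eq x = goto (pop (value-run e ds (appendDigit n false) _
      (trans (toℕ-fromℕ< _) (trans (cong (λ m → appendDigit m false ⊓ L) eq) (appendDigit-⊓ n L false))) x))
    value-run e (true ∷ ds) n v eq x = goto (pop (value-run e ds (appendDigit n true) _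
      (trans (toℕ-fromℕ< _) (trans (cong (λ m → appendDigit m true ⊓ L) eq) (appendDigit-⊓ n L true))) x))

  module _ {k d s c : List Σin} {t : ℕ} where

    digits-stuck : ∀ e ds {w p} → Stuck w →
      Runs (length ds * 3 + (3 + t)) (goto (digits e)) (store (map digit ds ++ w) k d s [] p [] c) false
    digits-stuck false [] end = goto (pop halt)
    digits-stuck false [] (atV w) = goto (pop halt)
    digits-stuck false [] (atX w) = goto (pop halt)
    digits-stuck false [] (atC w) = goto (pop halt)
    digits-stuck true [] end = goto (pop halt)
    digits-stuck true [] (atV w) = goto (pop halt)
    digits-stuck true [] (atX w) = goto (pop halt)
    digits-stuck true [] (atC w) = goto (pop halt)
    digits-stuck false (false ∷ ds) st = goto (pop (Runs-mono (n≤1+n _) (digits-stuck false ds st)))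
    digits-stuck false (true ∷ ds) st = goto (pop (Runs-mono (n≤1+n _) (digits-stuck false ds st)))
    digits-stuck true (false ∷ ds) st = goto (pop (push (digits-stuck true ds st)))
    digits-stuck true (true ∷ ds) st = goto (pop (push (digits-stuck true ds st)))

    connective-stuck : ∀ e ds {w p} → Stuck w →
      Runs (length ds * 3 + (3 + t)) (goto (connective e)) (store (map digit ds ++ w) k d s [] p [] c) false
    connective-stuck e [] end = goto (pop halt)
    connective-stuck e [] (atV w) = goto (pop halt)
    connective-stuck e [] (atX w) = goto (pop halt)
    connective-stuck e [] (atC w) = goto (pop halt)
    connective-stuck e (false ∷ ds) st = goto (pop (push (connective-stuck e ds st)))
    connective-stuck e (true ∷ ds) st = goto (pop (push (connective-stuck e ds st)))

  select-yes : ∀ b {m} (dec : Dec (m < L)) (j : Fin L) → m ≡ toℕ j → selectConnective b dec ≡ applyConnective b j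
  select-yes b (yes m<L) j eq = cong (applyConnective b) (toℕ-injective (trans (toℕ-fromℕ< m<L) eq))
  select-yes b (no ≮) j eq = ⊥-elim (≮ (subst (_< L) (sym eq) (toℕ<n j)))

  select-no : ∀ b {m} (dec : Dec (m < L)) → ¬ (m < L) → selectConnective b dec ≡ halt false
  select-no b (yes m<L) ≮ = ⊥-elim (≮ m<L)
  select-no b (no _) ≮ = refl

  module _ {w d s : List Σin} {r : Bool} where

    flipConstant-run : ∀ b c {t k code} → Runs t code (store w k d s [] [] [] (flag (b xor c))) r →
      Runs (2 + t) (flipConstant b code) (store w k d s [] [] [] (flag c)) r
    flipConstant-run false c x = Runs-mono (m≤n+m _ 2) x
    flipConstant-run true false x = pop (push x)
    flipConstant-run true true x = pop (Runs-mono (n≤1+n _) x)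

    pushArguments-run : ∀ b {n} (ss : Vec Bool n) Ks {c t code} →
      Runs t code (store w (symbols (arguments b ss ++ Ks)) d s [] [] [] c) r →
      Runs (n + t) (pushArguments b ss code) (store w (symbols Ks) d s [] [] [] c) r
    pushArguments-run b [] Ks x = x
    pushArguments-run b {suc n} (s ∷ ss) Ks {t = t} x = Runs-mono (≤-reflexive (+-suc n t)) (pushArguments-run b ss Ks (push x))

  finish-run : ∀ Ks {d e} ks c → Unique ks →
    Outcome (5 + length Ks * 2) (goto finish) (store [] (symbols Ks) e (serialise ks) [] [] [] (flag c))
      (Completes B Ks d [] (accumulated c ks))
  finish-run [] [] false u = reject (goto (pop (pop (pop halt)))) (λ { (_ , _ , ()) })
  finish-run [] [] true u = accept (goto (pop (pop (pop halt)))) (refl , (λ _ _ → false) , refl)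
  finish-run [] (k ∷ ks) c u = accept (goto (pop (pop halts))) (refl , accumulated-satisfiable c k ks u)
    where
    -- The first letter is a letter of the key or, if its word is empty, the terminator; either way
    -- the stack is seen to be nonempty.
    halts : ∀ {t st} → Runs (suc t) (answerCode (head (serialise (k ∷ ks)))) st true
    halts with keyWord k
    ... | [] = halt
    ... | _ ∷ _ = halt
  finish-run (argument false ∷ Ks) {d} ks c u =
    reject (goto (pop halt)) (nothing-completes-argument {B} {false} Ks {d} {accumulated c ks})
  finish-run (argument true ∷ Ks) {d} ks c u =
    reject (goto (pop halt)) (nothing-completes-argument {B} {true} Ks {d} {accumulated c ks})
  finish-run (leave ∷ Ks) ks c u with finish-run Ks ks c u
  ... | r , x , e = r , goto (pop x) , e

  -- Time and height budgets

  growth : ℕ → ℕ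
  growth N = N + arity-bound B + 3

  -- The summands of `variableTime` and `connectiveTime` follow the loops in order of execution. The
  -- first additive 3, one more than a completed digit loop needs, also covers a digit loop that
  -- halts at a wrong letter. `tokenTime` adds the costs of all kinds of token instead of taking a
  -- maximum.
  variableTime tokenTime : ℕ → ℕ → ℕ → ℕ
  connectiveTime : ℕ → ℕ → ℕ
  variableTime N M t = N * 3 + (3 + (N * 4 + (2 + (N * 3 + (2 + (M * (N * 3 + 7) + (N * 3 + (5 + (M * 3 + (2 + t))))))))))
  connectiveTime N t = N * 3 + (3 + (N * 2 + (2 + (2 + (arity-bound B + suc t)))))
  tokenTime N M t = 2 + (M * 3 + (3 + (variableTime N M 0 + connectiveTime N 0 + 3 + t)))

  finishTime : ℕ → ℕ
  finishTime M = 7 + M * 2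

  programTime : ℕ → ℕ → ℕ → ℕ
  programTime N M zero = finishTime M
  programTime N M (suc n) = tokenTime N M (programTime N M n)

  variableTime-+ : ∀ N M t → variableTime N M t ≡ variableTime N M 0 + t
  variableTime-+ N M t = arith N M t
    where
    arith : ∀ N M t → N * 3 + (3 + (N * 4 + (2 + (N * 3 + (2 + (M * (N * 3 + 7) + (N * 3 + (5 + (M * 3 + (2 + t)))))))))) ≡
      N * 3 + (3 + (N * 4 + (2 + (N * 3 + (2 + (M * (N * 3 + 7) + (N * 3 + (5 + (M * 3 + (2 + 0)))))))))) + t
    arith = solve-∀

  connectiveTime-+ : ∀ N t → connectiveTime N t ≡ connectiveTime N 0 + t
  connectiveTime-+ N t = arith N (arity-bound B) t
    where
    arith : ∀ N A t → N * 3 + (3 + (N * 2 + (2 + (2 + (A + suc t))))) ≡ N * 3 + (3 + (N * 2 + (2 + (2 + (A + 1))))) + t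
    arith = solve-∀

  -- `N` bounds depth plus unread letters, hence every key still to come; `M` bounds pending
  -- positions plus the serialised set. Each token is granted `growth N` further letters, room for a
  -- key with its terminator, for the arguments of a connective and for an argument with its X mark
  -- together.
  Continuation : ℕ → ℕ → ℕ → Set
  Continuation N M n = ∀ w Ks d ks c → length w ≤ n → d + n ≤ N →
    length Ks + length (serialise ks) + n * growth N ≤ M → Unique ks →
    Outcome (programTime N M n) (goto main) (store w (symbols Ks) (marks d) (serialise ks) [] [] [] (flag c))
      (Completes B Ks d w (accumulated c ks))

  budget-step : ∀ p {p′ N M} n → p′ ≤ p + growth N → p + suc n * growth N ≤ M → p′ + n * growth N ≤ M
  budget-step p {p′} {N} n le le′ = ≤-trans (+-monoˡ-≤ (n * growth N) le)
    (≤-trans (≤-reflexive (+-assoc p (growth N) (n * growth N))) le′)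

  module TokenStep {N M n : ℕ} (next : Continuation N M n) (ks : List Key) (c : Bool) (unique : Unique ks)
    (Ks : List Context) (d : ℕ) (d≤ : d + suc n ≤ N)
    (budget : suc (length Ks) + length (serialise ks) + suc n * growth N ≤ M) where

    T : ℕ
    T = programTime N M n

    d≤′ : d + n ≤ N
    d≤′ = ≤-trans (+-monoʳ-≤ d (n≤1+n n)) d≤

    next-outcome : ∀ b w → length w ≤ n →
      Outcome (3 + T) (afterContext next-token b) (store w (symbols Ks) (marks d) (serialise ks) [] [] [] (flag c))
        (Completes B (argument b ∷ Ks) d (sX ∷ w) (accumulated c ks))
    next-outcome b w len = Outcome-map (λ x → push (push (push x))) (Completes-X {B} {b} Ks {d} {w} {accumulated c ks})
      (next w (argument b ∷ leave ∷ Ks) (suc d) ks c len (≤-trans (≤-reflexive (sym (+-suc d n))) d≤)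
        (budget-step (suc (length Ks) + length (serialise ks)) n grow budget) unique)
      where
      arith : ∀ k s N A → suc k + s + (N + A + 3) ≡ suc (suc k) + s + (N + A + 2)
      arith = solve-∀
      grow : suc (suc (length Ks)) + length (serialise ks) ≤ suc (length Ks) + length (serialise ks) + growth N
      grow = ≤-trans (m≤m+n _ (N + arity-bound B + 2))
        (≤-reflexive (sym (arith (length Ks) (length (serialise ks)) N (arity-bound B))))

    module _ (ds : List Bool) (w′ : List Σin) (len : length ds + length w′ ≤ n) where

      length-w′ : length w′ ≤ n
      length-w′ = m+n≤o⇒n≤o (length ds) len

      length-ds : length ds ≤ N
      length-ds = ≤-trans (m+n≤o⇒m≤o (length ds) len) (m+n≤o⇒n≤o d d≤′)

      irrelevant-variable :
        Outcome (variableTime N M T) (goto (digits false))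
          (store (map digit ds ++ sE ∷ w′) (symbols Ks) (marks d) (serialise ks) [] [] [] (flag c))
          (Completes B (argument false ∷ Ks) d (sV ∷ map digit ds ++ sE ∷ w′) (accumulated c ks))
      irrelevant-variable = Outcome-map (λ x → Runs-mono time (digits-false-run ds x)) (Completes-V {B} {false} Ks {d} {w′} {accumulated c ks} ds)
        (next w′ Ks d ks c length-w′ d≤′ (budget-step (suc (length Ks) + length (serialise ks)) n (≤-trans (n≤1+n _) (m≤m+n _ (growth N))) budget) unique)
        where
        arith : ∀ N M T → N * 3 + (3 + (N * 4 + (2 + (N * 3 + (2 + (M * (N * 3 + 7) + (N * 3 + (5 + (M * 3 + (2 + T)))))))))) ≡
          N * 2 + (2 + T) + (N + (1 + (N * 4 + (2 + (N * 3 + (2 + (M * (N * 3 + 7) + (N * 3 + (5 + (M * 3 + 2))))))))))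
        arith = solve-∀
        time : length ds * 2 + (2 + T) ≤ variableTime N M T
        time = ≤-trans (+-monoˡ-≤ (2 + T) (*-monoˡ-≤ 2 length-ds))
          (≤-trans (m≤m+n _ _) (≤-reflexive (sym (arith N M T))))

      key : Key
      key = d , numeral ds

      length-key : length (keyWord key) ≤ N
      length-key = ≤-trans (≤-reflexive (length-keyWord-numeral d ds)) (≤-trans (+-monoʳ-≤ d (m+n≤o⇒m≤o (length ds) len)) d≤′)

      set-size : length (serialise ks) + suc N ≤ M
      set-size = ≤-trans (≤-trans (m≤m+n _ _) (≤-reflexive (sym (arith (length Ks) (length (serialise ks)) N (arity-bound B) (n * growth N))))) budget
        where
        arith : ∀ k s N A m → suc k + s + (N + A + 3 + m) ≡ s + suc N + (k + A + 3 + m)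
        arith = solve-∀

      length-marks : length (marks d) ≤ N
      length-marks = ≤-trans (≤-reflexive (length-replicate d)) (m+n≤o⇒m≤o d d≤′)

      length-reversed-marks : length (marks d ʳ++ []) ≤ N
      length-reversed-marks = ≤-trans (≤-reflexive (trans (length-ʳ++ (marks d)) (+-identityʳ _))) length-marks

      marks-restored : (marks d ʳ++ []) ʳ++ [] ≡ marks d
      marks-restored = trans (ʳ++-ʳ++ (marks d)) (++-identityʳ (marks d))

      relevant-variable-run : ∀ {b} →
        Runs T (goto main) (store w′ (symbols Ks) (marks d) (serialise (toggle key ks)) [] [] [] (flag c)) b →
        Runs (variableTime N M T) (goto (digits true))
          (store (map digit ds ++ sE ∷ w′) (symbols Ks) (marks d) (serialise ks) [] [] [] (flag c)) b
      relevant-variable-run {b} x =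
        Runs-mono (+-monoʳ-≤ (N * 3) (n≤1+n _)) (Runs-loop 3 length-ds (digits-true-run ds
          (Runs-loop 4 length-marks (depthOut-run (marks d)
            (Runs-loop 3 length-reversed-marks (depthIn-run (marks d ʳ++ []) toggled))))))
        where
        toggled : Runs (M * (N * 3 + 7) + (N * 3 + (5 + (M * 3 + (2 + T))))) (goto (compare true))
          (store w′ (symbols Ks) ((marks d ʳ++ []) ʳ++ []) (serialise ks) [] (marks d ʳ++ (map digit ds ʳ++ [])) [] (flag c)) b
        toggled rewrite marks-restored | sym (keyWord-numeral d ds) =
          Runs-loop (N * 3 + 7) (m+n≤o⇒m≤o (length (serialise ks)) set-size)
            (toggle-run ks key N M length-key set-size x)

      relevant-variable :
        Outcome (variableTime N M T) (goto (digits true))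
          (store (map digit ds ++ sE ∷ w′) (symbols Ks) (marks d) (serialise ks) [] [] [] (flag c))
          (Completes B (argument true ∷ Ks) d (sV ∷ map digit ds ++ sE ∷ w′) (accumulated c ks))
      relevant-variable = Outcome-map relevant-variable-run
        (mk⇔ (Equivalence.to (Completes-V {B} {true} Ks {d} {w′} {accumulated c ks} ds) ∘ Completes-cong Ks added)
             (Completes-cong Ks (sym ∘ added) ∘ Equivalence.from (Completes-V {B} {true} Ks {d} {w′} {accumulated c ks} ds)))
        (next w′ Ks d (toggle key ks) c length-w′ d≤′ (budget-step (suc (length Ks) + length (serialise ks)) n grow budget) (toggle-unique key ks unique))
        where
        added : ∀ ξ → accumulated c (toggle key ks) ξ ≡ ξ d (numeral ds) xor accumulated c ks ξ
        added ξ = trans (cong (c xor_) (keySum-toggle ξ key ks)) (swap-xor c (ξ d (numeral ds)) (keySum ξ ks))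
        arith : ∀ k s N A → suc k + s + (N + A + 3) ≡ k + (s + suc N) + (A + 3)
        arith = solve-∀
        grow : length Ks + length (serialise (toggle key ks)) ≤ suc (length Ks) + length (serialise ks) + growth N
        grow = ≤-trans (+-monoʳ-≤ (length Ks) (≤-trans (length-serialise-toggle key ks) (+-monoʳ-≤ _ (s≤s length-key))))
          (≤-trans (m≤m+n _ _) (≤-reflexive (sym (arith (length Ks) (length (serialise ks)) N (arity-bound B)))))

      connective-value-run : ∀ b {t r s} →
        (∀ (v : Fin (suc L)) → toℕ v ≡ numeral ds ⊓ L → Runs t (selectConnective b (toℕ v <? L)) (store w′ (symbols Ks) (marks d) s [] [] [] (flag c)) r) →
        Runs (N * 3 + (3 + (N * 2 + (2 + t)))) (goto (connective b))
          (store (map digit ds ++ sE ∷ w′) (symbols Ks) (marks d) s [] [] [] (flag c)) r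
      connective-value-run b {t} {r} {s} x =
        Runs-mono (+-monoʳ-≤ (N * 3) (n≤1+n _)) (Runs-loop 3 length-ds (connective-run b ds
          (subst (λ p → Runs _ (goto (value b fzero)) (store w′ (symbols Ks) (marks d) s [] p [] (flag c)) r) (map-ʳ++ digit ds)
            (Runs-loop 2 length-reversed (value-run b (ds ʳ++ []) 0 fzero refl
              (λ v eq → x v (trans eq (cong (_⊓ L) (numeral-foldl ds)))))))))
        where
        length-reversed : length (ds ʳ++ []) ≤ N
        length-reversed = ≤-trans (≤-reflexive (trans (length-ʳ++ ds) (+-identityʳ _))) length-ds

      connective-outcome : ∀ b →
        Outcome (connectiveTime N T) (goto (connective b))
          (store (map digit ds ++ sE ∷ w′) (symbols Ks) (marks d) (serialise ks) [] [] [] (flag c))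
          (Completes B (argument b ∷ Ks) d (sC ∷ map digit ds ++ sE ∷ w′) (accumulated c ks))
      connective-outcome b with numeral ds <? L
      ... | no ≮ = reject (connective-value-run b rejects) (no-connective {B} {b} Ks {d} {w′} {accumulated c ks} ds ≮)
        where
        rejects : ∀ (v : Fin (suc L)) → toℕ v ≡ numeral ds ⊓ L → Runs _ (selectConnective b (toℕ v <? L)) _ false
        rejects v eq rewrite select-no b (toℕ v <? L) (λ lt → ≮ (⊓-<ˡ (subst (_< L) eq lt))) = halt
      ... | yes n<L = Outcome-map (λ x → connective-value-run b (applies x))
        (mk⇔ (Equivalence.to (Completes-C b j Ks {d} {w′} {accumulated c ks} ds n≡j) ∘ Completes-cong (arguments b (coefficients j) ++ Ks) added)
             (Completes-cong (arguments b (coefficients j) ++ Ks) (sym ∘ added) ∘ Equivalence.from (Completes-C b j Ks {d} {w′} {accumulated c ks} ds n≡j)))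
        (next w′ (arguments b (coefficients j) ++ Ks) d ks ((b ∧ constant j) xor c) length-w′ d≤′ (budget-step (suc (length Ks) + length (serialise ks)) n grow budget) unique)
        where
        j : Fin L
        j = fromℕ< n<L
        n≡j : numeral ds ≡ toℕ j
        n≡j = sym (toℕ-fromℕ< n<L)
        added : ∀ ξ → accumulated ((b ∧ constant j) xor c) ks ξ ≡ (b ∧ constant j) xor accumulated c ks ξ
        added ξ = xor-assoc (b ∧ constant j) c (keySum ξ ks)
        length-arguments : ∀ {n} (ss : Vec Bool n) → length (arguments b ss) ≡ n
        length-arguments [] = refl
        length-arguments (s ∷ ss) = cong suc (length-arguments ss)
        arith : ∀ k s N A → suc k + s + (N + A + 3) ≡ A + k + s + (N + 4)
        arith = solve-∀
        grow : length (arguments b (coefficients j) ++ Ks) + length (serialise ks) ≤ suc (length Ks) + length (serialise ks) + growth N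
        grow = ≤-trans (+-monoˡ-≤ (length (serialise ks)) (≤-trans
            (≤-reflexive (trans (length-++ (arguments b (coefficients j))) (cong (_+ length Ks) (length-arguments (coefficients j)))))
            (+-monoˡ-≤ (length Ks) (arity≤bound B j))))
          (≤-trans (m≤m+n _ _) (≤-reflexive (sym (arith (length Ks) (length (serialise ks)) N (arity-bound B)))))
        applies : ∀ {r} → Runs T (goto main) (store w′ (symbols (arguments b (coefficients j) ++ Ks)) (marks d) (serialise ks) [] [] []
            (flag ((b ∧ constant j) xor c))) r →
          ∀ (v : Fin (suc L)) → toℕ v ≡ numeral ds ⊓ L →
          Runs (2 + (arity-bound B + suc T)) (selectConnective b (toℕ v <? L))
            (store w′ (symbols Ks) (marks d) (serialise ks) [] [] [] (flag c)) r
        applies x v eq rewrite select-yes b (toℕ v <? L) j (trans eq (trans (m≤n⇒m⊓n≡m (<⇒≤ n<L)) n≡j)) =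
          flipConstant-run (b ∧ constant j) c (Runs-mono (+-mono-≤ (arity≤bound B j) (n≤1+n T))
            (pushArguments-run b (coefficients j) Ks x))

  -- The counter `n` is spent once for each token, but a token may have many letters, so the input
  -- can end while `n` is still positive.
  finishTime≤ : ∀ N M n → finishTime M ≤ programTime N M n
  finishTime≤ N M zero = ≤-refl
  finishTime≤ N M (suc n) = ≤-trans (finishTime≤ N M n) (≤-trans (m≤n+m _ _)
    (≤-trans (m≤n+m _ 3) (≤-trans (m≤n+m _ (M * 3)) (m≤n+m _ 2))))

  -- Induction on a bound for the unread length, since the suffix left by a token is found only by
  -- scanning its numeral.
  main-run : ∀ {N M} n → Continuation N M n
  main-run {N} {M} n [] Ks d ks c len d≤ budget unique =
    Outcome-map (λ x → Runs-mono time (goto (pop x))) (mk⇔ (λ x → x) (λ x → x)) (finish-run Ks ks c unique)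
    where
    time : 7 + length Ks * 2 ≤ programTime N M n
    time = ≤-trans (+-monoʳ-≤ 7 (*-monoˡ-≤ 2 (m+n≤o⇒m≤o (length Ks) (m+n≤o⇒m≤o (length Ks + _) budget)))) (finishTime≤ N M n)
  main-run {N} {M} (suc n) (a ∷ w) Ks d ks c (s≤s len) d≤ budget unique = token a
    where
    T = programTime N M n
    t = variableTime N M 0 + connectiveTime N 0 + 3 + T

    module Step {Ks′ : List Context} {d′ : ℕ} (lt : length Ks′ < length Ks) (le : d′ ≤ d) where
      open TokenStep {N} {M} {n} (main-run n) ks c unique Ks′ d′ (≤-trans (+-monoˡ-≤ (suc n) le) d≤)
        (≤-trans (+-monoˡ-≤ (suc n * growth N) (+-monoˡ-≤ (length (serialise ks)) lt)) budget) public

    Goal : Code → List Context → ℕ → List Context → Σin → Set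
    Goal code Ks₀ d₀ Ks₁ a = Outcome t code (store w (symbols Ks₀) (marks d₀) (serialise ks) [] [] [] (flag c))
      (Completes B Ks₁ d₀ (a ∷ w) (accumulated c ks))

    weaken : ∀ {u code s P} → u ≤ t → Outcome u code s P → Outcome t code s P
    weaken le (b , x , e) = b , Runs-mono le x , e

    V≤ : variableTime N M T ≤ t
    V≤ = ≤-trans (≤-reflexive (variableTime-+ N M T)) (+-monoˡ-≤ T (≤-trans (m≤m+n _ (connectiveTime N 0)) (m≤m+n _ 3)))

    C≤ : connectiveTime N T ≤ t
    C≤ = ≤-trans (≤-reflexive (connectiveTime-+ N T)) (+-monoˡ-≤ T (≤-trans (m≤n+m _ (variableTime N M 0)) (m≤m+n _ 3)))

    X≤ : 3 + T ≤ t
    X≤ = +-monoˡ-≤ T (m≤n+m 3 _)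

    length-stuck : ∀ ds u → length (map digit ds ++ u) ≤ n → length ds ≤ N
    length-stuck ds u l = ≤-trans (m+n≤o⇒m≤o (length ds) (≤-trans (≤-reflexive (length-digits ds u)) l))
      (≤-trans (n≤1+n n) (m+n≤o⇒n≤o d d≤))

    length-terminated : ∀ ds u → length (map digit ds ++ sE ∷ u) ≤ n → length ds + length u ≤ n
    length-terminated ds u l = ≤-trans (≤-trans (+-monoʳ-≤ (length ds) (n≤1+n _)) (≤-reflexive (length-digits ds (sE ∷ u)))) l

    after : ∀ {tok a} → Starts a tok →
      ∀ b Ks′ d′ → length Ks′ < length Ks → d′ ≤ d → Goal (afterContext tok b) Ks′ d′ (argument b ∷ Ks′) a
    after p b Ks′ d′ lt le with digitView w
    after startV false Ks′ d′ lt le | terminated ds u =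
      weaken V≤ (Step.irrelevant-variable lt le ds u (length-terminated ds u len))
    after startV true Ks′ d′ lt le | terminated ds u =
      weaken V≤ (Step.relevant-variable lt le ds u (length-terminated ds u len))
    after startV b Ks′ d′ lt le | stuck ds {u} st =
      weaken V≤ (reject (Runs-loop 3 (length-stuck ds u len) (digits-stuck b ds st)) (stuck-V {B} {b} Ks′ {d′} {u} {accumulated c ks} ds st))
    after startC b Ks′ d′ lt le | terminated ds u =
      weaken C≤ (Step.connective-outcome lt le ds u (length-terminated ds u len) b)
    after startC b Ks′ d′ lt le | stuck ds {u} st =
      weaken C≤ (reject (Runs-loop 3 (length-stuck ds u len) (connective-stuck b ds st)) (stuck-C {B} {b} Ks′ {d′} {u} {accumulated c ks} ds st))
    after startX b Ks′ d′ lt le | _ =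
      weaken X≤ (Step.next-outcome lt le b _ len)

    length-Ks : length Ks ≤ M
    length-Ks = m+n≤o⇒m≤o (length Ks) (m+n≤o⇒m≤o (length Ks + _) budget)

    enter : ∀ {tok a} → Starts a tok →
      Outcome (tokenTime N M T) (goto main) (store (a ∷ w) (symbols Ks) (marks d) (serialise ks) [] [] [] (flag c))
        (Completes B Ks d (a ∷ w) (accumulated c ks))
    enter {tok} {a} p with context-run tok Ks d (after p)
    ... | b , x , eq = b , goto (pop (dispatch p x)) , eq
      where
      dispatch : ∀ {a tok s b} → Starts a tok → Runs (length Ks * 3 + (3 + t)) (goto (context tok)) s b →
        Runs (M * 3 + (3 + t)) (mainCode (just a)) s b
      dispatch startV = Runs-loop 3 length-Ks
      dispatch startX = Runs-loop 3 length-Ks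
      dispatch startC = Runs-loop 3 length-Ks

    token : ∀ a → Outcome (tokenTime N M T) (goto main) (store (a ∷ w) (symbols Ks) (marks d) (serialise ks) [] [] [] (flag c))
      (Completes B Ks d (a ∷ w) (accumulated c ks))
    token σ0 = reject (goto (pop (Runs-mono 1≤ halt))) (not-token Ks not-s0)
      where 1≤ = ≤-trans (s≤s z≤n) (m≤n+m (3 + t) (M * 3))
    token σ1 = reject (goto (pop (Runs-mono 1≤ halt))) (not-token Ks not-s1)
      where 1≤ = ≤-trans (s≤s z≤n) (m≤n+m (3 + t) (M * 3))
    token σV = enter startV
    token σX = enter startX
    token σC = enter startC
    token σE = reject (goto (pop (Runs-mono 1≤ halt))) (not-token Ks not-sE)
      where 1≤ = ≤-trans (s≤s z≤n) (m≤n+m (3 + t) (M * 3))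

-- Polynomial bounds

Polynomial : (ℕ → ℕ) → Set
Polynomial f = ∃ λ c → ∃ λ d → ∀ n → f n ≤ c * suc n ^ d

poly-const : ∀ k → Polynomial (λ _ → k)
poly-const k = k , 0 , λ n → ≤-reflexive (sym (*-identityʳ k))

poly-id : Polynomial (λ n → n)
poly-id = 1 , 1 , λ n → ≤-trans (n≤1+n n) (≤-reflexive (sym (trans (*-identityˡ _) (*-identityʳ (suc n)))))

infixl 6 _⊕_
infixl 7 _⊗_

_⊕_ : ∀ {f g} → Polynomial f → Polynomial g → Polynomial (λ n → f n + g n)
(c , d , p) ⊕ (c′ , d′ , p′) = c + c′ , d + d′ , λ n → ≤-trans
  (+-mono-≤ (≤-trans (p n) (*-monoʳ-≤ c (^-monoʳ-≤ (suc n) (m≤m+n d d′))))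
    (≤-trans (p′ n) (*-monoʳ-≤ c′ (^-monoʳ-≤ (suc n) (m≤n+m d′ d)))))
  (≤-reflexive (sym (*-distribʳ-+ (suc n ^ (d + d′)) c c′)))

_⊗_ : ∀ {f g} → Polynomial f → Polynomial g → Polynomial (λ n → f n * g n)
(c , d , p) ⊗ (c′ , d′ , p′) = c * c′ , d + d′ , λ n → ≤-trans (*-mono-≤ (p n) (p′ n))
  (≤-reflexive (trans (interchange c (suc n ^ d) c′ (suc n ^ d′)) (cong (c * c′ *_) (sym (^-distribˡ-+-* (suc n) d d′)))))
  where
  interchange : ∀ a x b y → a * x * (b * y) ≡ a * b * (x * y)
  interchange = solve-∀

poly-≤ : ∀ {f g} → (∀ n → f n ≤ g n) → Polynomial g → Polynomial f
poly-≤ le (c , d , p) = c , d , λ n → ≤-trans (le n) (p n)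

polyTime-of-program : ∀ {m-1 Label} (finite : Finite Label) (body : Label → StackProgram.Code (suc m-1) Label) (start : Label)
  {f : ℕ → ℕ} → Polynomial f → (P : List Σin → Set) →
  (∀ w → Σ Bool λ b → StackProgram.Halts (suc m-1) Label body (f (length w)) (body start) (w ∷ Vec.replicate m-1 []) b × (b ≡ true ⇔ P w)) →
  PolyTimeDecidable P
polyTime-of-program finite body start {f} pf P program
  -- The product is the program time `t` times `cost (length w + t)`, since no stack outgrows the
  -- input length plus the running time.
  with pf ⊗ ((poly-id ⊕ pf) ⊗ poly-const 2 ⊕ poly-const 3)
... | c , d , bound = machine , c , d , λ w → let b , x , e = program w in b , run-mono (bound (length w)) (machine-halts x) , e
  where
  open Simulation _ finite body start
  open OneTape finite-Cell finite-Phase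

-- Polynomial running time of the program

module Theorem (B : List BFun) (linear : All IsLinear B) where

  open Decision B linear
  open StackProgram 8 Label
  open Correctness B linear

  -- The 1 is the single pending position at the start, when the set is empty; then comes the growth
  -- for `N` tokens.
  stackBound : ℕ → ℕ
  stackBound N = 1 + N * growth N

  -- The extra step pushes the initial pending position.
  time : ℕ → ℕ
  time N = suc (programTime N (stackBound N) N)

  poly-time : Polynomial time
  poly-time = poly-≤ (λ N → ≤-reflexive (cong suc (linear-time N (stackBound N) N)))
    (poly-const 1 ⊕ (poly-id ⊗ token ⊕ (poly-const 7 ⊕ M ⊗ poly-const 2)))
    where
    infixl 7 _⊗ₖ_
    -- `programTime` is defined by iteration, while polynomial bounds combine only through sums and
    -- products; each token adds a fixed amount, which gives a closed form.
    linear-time : ∀ N M n → programTime N M n ≡ n * tokenTime N M 0 + finishTime M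
    linear-time N M zero = refl
    linear-time N M (suc n) = trans (cong (tokenTime N M) (linear-time N M n))
      (arith (M * 3) (variableTime N M 0 + connectiveTime N 0 + 3) (n * tokenTime N M 0) (finishTime M))
      where
      arith : ∀ m v x y → 2 + (m + (3 + (v + (x + y)))) ≡ 2 + (m + (3 + (v + 0))) + x + y
      arith = solve-∀
    _⊗ₖ_ : ∀ {f} → Polynomial f → ∀ k → Polynomial (λ n → f n * k)
    p ⊗ₖ k = p ⊗ poly-const k
    k⊕ : ∀ k {f} → Polynomial f → Polynomial (λ n → k + f n)
    k⊕ k p = poly-const k ⊕ p
    N : Polynomial (λ n → n)
    N = poly-id
    M : Polynomial stackBound
    M = poly-const 1 ⊕ N ⊗ (N ⊕ poly-const (arity-bound B) ⊕ poly-const 3)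
    variable-poly : Polynomial (λ n → variableTime n (stackBound n) 0)
    variable-poly = N ⊗ₖ 3 ⊕ k⊕ 3 (N ⊗ₖ 4 ⊕ k⊕ 2 (N ⊗ₖ 3 ⊕ k⊕ 2 (M ⊗ (N ⊗ₖ 3 ⊕ poly-const 7) ⊕ (N ⊗ₖ 3 ⊕ k⊕ 5 (M ⊗ₖ 3 ⊕ poly-const 2)))))
    connective-poly : Polynomial (λ n → connectiveTime n 0)
    connective-poly = N ⊗ₖ 3 ⊕ k⊕ 3 (N ⊗ₖ 2 ⊕ k⊕ 2 (k⊕ 2 (poly-const (arity-bound B) ⊕ poly-const 1)))
    token : Polynomial (λ n → tokenTime n (stackBound n) 0)
    token = k⊕ 2 (M ⊗ₖ 3 ⊕ k⊕ 3 (variable-poly ⊕ connective-poly ⊕ poly-const 3 ⊕ poly-const 0))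

-- Reduction to the initial state

shift : ℕ → Structure → Structure
shift i ξ n = ξ (n + i)

mutual
  -- Satisfiability allows any state, whereas `Completes` evaluates from state 0. Only later states
  -- influence a formula, so the earlier ones may be cut off.
  eval-shift : ∀ {B} ξ i n (φ : Form B) → eval (shift i ξ) n φ ≡ eval ξ (n + i) φ
  eval-shift ξ i n (var v) = refl
  eval-shift ξ i n (X φ) = eval-shift ξ i (suc n) φ
  eval-shift {B} ξ i n (app j φs) = cong (proj₂ (List.lookup B j)) (evalVec-shift ξ i n φs)

  evalVec-shift : ∀ {B m} ξ i n (φs : Vec (Form B) m) → evalVec (shift i ξ) n φs ≡ evalVec ξ (n + i) φs
  evalVec-shift ξ i n [] = refl
  evalVec-shift ξ i n (φ ∷ φs) = cong₂ _∷_ (eval-shift ξ i n φ) (evalVec-shift ξ i n φs)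

Completes⇔SATLang : ∀ {B} w → Completes B (argument true ∷ []) 0 w (accumulated false []) ⇔ SATLang B w
Completes⇔SATLang {B} w = mk⇔ to from
  where
  to : Completes B (argument true ∷ []) 0 w (accumulated false []) → SATLang B w
  to (φ , .[] , p , refl , ξ , q) = φ , trans (sym (++-identityʳ (enc φ))) (sym p) , ξ , 0 , trans (sym (xor-identityʳ _)) q
  from : SATLang B w → Completes B (argument true ∷ []) 0 w (accumulated false [])
  from (φ , p , ξ , i , q) = φ , [] , trans (sym p) (sym (++-identityʳ (enc φ))) , refl , shift i ξ ,
    trans (xor-identityʳ _) (trans (eval-shift ξ i 0 φ) q)

theorem3p8 : (B : List BFun) → All IsLinear B → PolyTimeDecidable (SATLang B)
theorem3p8 B linear = polyTime-of-program finite-Label body start poly-time (SATLang B) λ w →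
  Outcome-map (λ x → push x) (Completes⇔SATLang w)
    (main-run (length w) w (argument true ∷ []) 0 [] false ≤-refl ≤-refl ≤-refl [])
  where
  open Decision B linear
  open StackProgram 8 Label
  open Correctness B linear
  open Theorem B linear
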